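{- Let $\mathcal C$ be a cartesian $R$-differential category, where $R$ has multiplicative inverses for integers. For every integer $n\ge 1$ and every $f\in\mathcal C(X,Y)$, $$t_nf=\sum_{k=1}^{n}\ \sum_{\substack{i_1,\dots,i_k>0\\ i_1+\cdots+i_k=n}}\frac1{k!}\,f^{(k)}\circ\langle\pi_0,\pi_{i_1},\dots,\pi_{i_k}\rangle .$$
   Context: $R$ is a commutative semiring with multiplicative inverses for integers: for each integer $n\ge1$ there is $\frac1n\in R$ with $\frac1n\cdot(1_R+\cdots+1_R)=1_R$ ($n$ summands). A map between $R$-semimodules is $R$-additive if it preserves sums, $0$ and the action of $R$. A left $R$-additive category is a category $\mathcal C$ whose hom-sets are $R$-semimodules and such that every precomposition map $\_\circ f$ is $R$-additive; a morphism $h:Y\to Z$ is $R$-additive if every postcomposition map $h\circ\_:\mathcal C(X,Y)\to\mathcal C(X,Z)$ is $R$-additive. A cartesian left $R$-additive category is one with finite products whose projections are $R$-additive. $\langle\cdots\rangle$ denotes tupling. Put $SX=X\times X$ with projections $\pi_0,\pi_1:SX\to X$. A derivative is a family of operators $D:\mathcal C(X,Y)\to\mathcal C(SX,Y)$ such that: (i) $Dp=p\circ\pi_1$ for every product projection $p:X_0\times\cdots\times X_n\to X_i$; (ii) $D$ is $R$-additive; (iii) $D\,\mathrm{id}=\pi_1$ and $D(g\circ f)=Dg\circ\langle f\circ\pi_0,Df\rangle$; (iv) $Df$ is $R$-additive in its second argument, i.e. $u\mapsto Df\circ\langle x,u\rangle$ is $R$-additive; (v) $DDf\circ\langle\langle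 x,0\rangle,\langle 0,u\rangle\rangle=Df\circ\langle x,u\rangle$; (vi) $DDf\circ\langle\langle x,u\rangle,\langle v,w\rangle\rangle=DDf\circ\langle\langle x,v\rangle,\langle u,w\rangle\rangle$. A cartesian $R$-differential category is a cartesian left $R$-additive category with a derivative. $S_nX=X^{n+1}$ with projections $\pi_0,\dots,\pi_n:S_nX\to X$. The $n$-th derivative $f^{(n)}:S_nX\to Y$ of $f:X\to Y$ is the iterated partial derivative with respect to the base point: $f^{(0)}=f$ and $f^{(n+1)}=D(f^{(n)})\circ\langle\langle\pi_0,\dots,\pi_n\rangle,\langle\pi_{n+1},0,\dots,0\rangle\rangle$. For $n\ge1$ let $\nu_n=\langle\langle\pi_0,\dots,\pi_{n-1}\rangle,\langle\tfrac1n\pi_1,\tfrac2n\pi_2,\dots,\tfrac nn\pi_n\rangle\rangle:S_nX\to SS_{n-1}X$. Define $t_nf:S_nX\to Y$ by $t_0f=f$ and $t_{n+1}f=D(t_nf)\circ\nu_{n+1}$. -}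

module Defs where

open import Algebra.Bundles using (CommutativeSemiring)
open import Algebra.Module.Bundles using (Semimodule)
open import Algebra.Module.Morphism.Structures using (module SemimoduleMorphisms)
import Algebra.Definitions as Definitions
import Algebra.Definitions.RawSemiring as RawSemiringOps
open import Data.Fin.Base using (Fin; zero; suc; toℕ; fromℕ; inject₁)
open import Data.List.Base as List using (List)
open import Data.Nat.Base as ℕ using (ℕ; zero; suc; pred; NonZero; _!)
import Data.Nat.Properties as ℕ
open import Data.Product.Base using (proj₁) renaming (_×_ to _∧_)
open import Data.Vec.Base as Vec using (Vec)
open import Data.Vec.Functional as Vector using (Vector)
open import Data.Vec.Relation.Unary.All as All using (All)
open import Function.Base using () renaming (_∘_ to _⊙_)
open import Level using (Level; _⊔_) renaming (suc to lsuc)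
open import Relation.Binary.PropositionalEquality.Core using (_≡_)
open import Relation.Nullary.Decidable.Core using (Dec; _×-dec_)

private
  variable
    r ℓr o m ℓm : Level

module _ (R : CommutativeSemiring r ℓr) where
  open CommutativeSemiring R
  open Definitions _≈_ using (LeftInvertible)
  open RawSemiringOps rawSemiring using () renaming (_×_ to _times_)

  fromNat : ℕ → Carrier
  fromNat n = n times 1#

  HasIntegerInverses : Set (r ⊔ ℓr)
  HasIntegerInverses = ∀ n → .{{_ : NonZero n}} → LeftInvertible 1# _*_ (fromNat n)

module Fractions (R : CommutativeSemiring r ℓr) (inv : HasIntegerInverses R) where
  open CommutativeSemiring R

  1/_ : ∀ n → .{{_ : NonZero n}} → Carrier
  1/ n = proj₁ (inv n)

  frac : ∀ k n → .{{_ : NonZero n}} → Carrier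
  frac k n = (1/ n) * fromNat R k

  1/fact : ℕ → Carrier
  1/fact n = 1/_ (n !) {{n ℕ.!≢0}}

module _ {R : CommutativeSemiring r ℓr} where

  IsAdditive : (M N : Semimodule R m ℓm) →
               (Semimodule.Carrierᴹ M → Semimodule.Carrierᴹ N) → Set _
  IsAdditive M N = IsSemimoduleHomomorphism
    where open SemimoduleMorphisms (Semimodule.rawSemimodule M) (Semimodule.rawSemimodule N)

record LeftAdditiveCategory (R : CommutativeSemiring r ℓr) o m ℓm
                            : Set (r ⊔ ℓr ⊔ lsuc (o ⊔ m ⊔ ℓm)) where
  infixr 9 _∘_
  infixr 7 _*ₗ_
  infixl 6 _+_
  infix  4 _≈_

  open CommutativeSemiring R using () renaming (Carrier to Scalar)

  field
    Obj : Set o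
    hom : Obj → Obj → Semimodule R m ℓm

  Hom : Obj → Obj → Set m
  Hom X Y = Semimodule.Carrierᴹ (hom X Y)

  _≈_ : ∀ {X Y} → Hom X Y → Hom X Y → Set ℓm
  _≈_ {X} {Y} = Semimodule._≈ᴹ_ (hom X Y)

  _+_ : ∀ {X Y} → Hom X Y → Hom X Y → Hom X Y
  _+_ {X} {Y} = Semimodule._+ᴹ_ (hom X Y)

  0ₕ : ∀ {X Y} → Hom X Y
  0ₕ {X} {Y} = Semimodule.0ᴹ (hom X Y)

  _*ₗ_ : ∀ {X Y} → Scalar → Hom X Y → Hom X Y
  _*ₗ_ {X} {Y} = Semimodule._*ₗ_ (hom X Y)

  field
    id        : ∀ {X} → Hom X X
    _∘_       : ∀ {X Y Z} → Hom Y Z → Hom X Y → Hom X Z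
    ∘-cong    : ∀ {X Y Z} {g g′ : Hom Y Z} {f f′ : Hom X Y} →
                g ≈ g′ → f ≈ f′ → g ∘ f ≈ g′ ∘ f′
    identityˡ : ∀ {X Y} (f : Hom X Y) → id ∘ f ≈ f
    identityʳ : ∀ {X Y} (f : Hom X Y) → f ∘ id ≈ f
    assoc     : ∀ {W X Y Z} (h : Hom Y Z) (g : Hom X Y) (f : Hom W X) →
                (h ∘ g) ∘ f ≈ h ∘ (g ∘ f)
    precomposition-additive : ∀ {X Y Z} (f : Hom X Y) →
                              IsAdditive (hom Y Z) (hom X Z) (_∘ f)

  AdditiveMorphism : ∀ {Y Z} → Hom Y Z → Set _
  AdditiveMorphism {Y} {Z} h = ∀ {X} → IsAdditive (hom X Y) (hom X Z) (h ∘_)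

  ∑ : ∀ {a} {A : Set a} {X Y} → List A → (A → Hom X Y) → Hom X Y
  ∑ xs F = List.foldr (λ x s → F x + s) 0ₕ xs

  infix 5 ∑
  syntax ∑ xs (λ x → F) = ∑[ x ∈ xs ] F

record CartesianLeftAdditiveCategory (R : CommutativeSemiring r ℓr) o m ℓm
                                     : Set (r ⊔ ℓr ⊔ lsuc (o ⊔ m ⊔ ℓm)) where
  infixr 2 _×_

  field
    leftAdditiveCategory : LeftAdditiveCategory R o m ℓm

  open LeftAdditiveCategory leftAdditiveCategory public

  field
    ⊤        : Obj
    !        : ∀ {Z} → Hom Z ⊤
    !-unique : ∀ {Z} (h : Hom Z ⊤) → ! ≈ h

    _×_       : Obj → Obj → Obj
    fst       : ∀ {X Y} → Hom (X × Y) X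
    snd       : ∀ {X Y} → Hom (X × Y) Y
    ⟨_,_⟩     : ∀ {X Y Z} → Hom Z X → Hom Z Y → Hom Z (X × Y)
    fst-⟨,⟩   : ∀ {X Y Z} (f : Hom Z X) (g : Hom Z Y) → fst ∘ ⟨ f , g ⟩ ≈ f
    snd-⟨,⟩   : ∀ {X Y Z} (f : Hom Z X) (g : Hom Z Y) → snd ∘ ⟨ f , g ⟩ ≈ g
    ⟨,⟩-unique : ∀ {X Y Z} {f : Hom Z X} {g : Hom Z Y} {h : Hom Z (X × Y)} →
                 fst ∘ h ≈ f → snd ∘ h ≈ g → ⟨ f , g ⟩ ≈ h

    fst-additive : ∀ {X Y} → AdditiveMorphism (fst {X} {Y})
    snd-additive : ∀ {X Y} → AdditiveMorphism (snd {X} {Y})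

  -- The nonempty product X₀ × (X₁ × (⋯ × Xₙ)); the unary one is X₀ itself.

  ∏ : ∀ {n} → Vector Obj (suc n) → Obj
  ∏ {zero}  Xs = Xs zero
  ∏ {suc n} Xs = Xs zero × ∏ (Xs ⊙ suc)

  proj : ∀ {n} (Xs : Vector Obj (suc n)) (i : Fin (suc n)) → Hom (∏ Xs) (Xs i)
  proj {zero}  Xs zero    = id
  proj {suc n} Xs zero    = fst
  proj {suc n} Xs (suc i) = proj (Xs ⊙ suc) i ∘ snd

  tuple : ∀ {n} (Xs : Vector Obj (suc n)) {Z} → (∀ i → Hom Z (Xs i)) → Hom Z (∏ Xs)
  tuple {zero}  Xs fs = fs zero
  tuple {suc n} Xs fs = ⟨ fs zero , tuple (Xs ⊙ suc) (fs ⊙ suc) ⟩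

  -- S X is definitionally equal to S[ 1 ] X, and X to S[ 0 ] X.

  S : Obj → Obj
  S X = X × X

  S[_] : ℕ → Obj → Obj
  S[ n ] X = ∏ {n} (λ _ → X)

  π : ∀ n {X} → Fin (suc n) → Hom (S[ n ] X) X
  π n {X} = proj (λ _ → X)

  ⟪_⟫ : ∀ {n X Z} → Vector (Hom Z X) (suc n) → Hom Z (S[ n ] X)
  ⟪_⟫ {X = X} = tuple (λ _ → X)

record CartesianDifferentialCategory (R : CommutativeSemiring r ℓr) o m ℓm
                                     : Set (r ⊔ ℓr ⊔ lsuc (o ⊔ m ⊔ ℓm)) where
  field
    cartesianLeftAdditiveCategory : CartesianLeftAdditiveCategory R o m ℓm

  open CartesianLeftAdditiveCategory cartesianLeftAdditiveCategory public

  field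
    D : ∀ {X Y} → Hom X Y → Hom (S X) Y

    D-proj : ∀ {n} (Xs : Vector Obj (suc n)) (i : Fin (suc n)) →
             D (proj Xs i) ≈ proj Xs i ∘ snd

    D-additive : ∀ {X Y} → IsAdditive (hom X Y) (hom (S X) Y) D

    D-id : ∀ {X} → D (id {X}) ≈ snd
    D-∘  : ∀ {X Y Z} (g : Hom Y Z) (f : Hom X Y) →
           D (g ∘ f) ≈ D g ∘ ⟨ f ∘ fst , D f ⟩

    D-additive₂ : ∀ {X Y Z} (f : Hom X Y) (x : Hom Z X) →
                  IsAdditive (hom Z X) (hom Z Y) (λ u → D f ∘ ⟨ x , u ⟩)

    D-linear : ∀ {X Y Z} (f : Hom X Y) (x u : Hom Z X) →
               D (D f) ∘ ⟨ ⟨ x , 0ₕ ⟩ , ⟨ 0ₕ , u ⟩ ⟩ ≈ D f ∘ ⟨ x , u ⟩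

    D-symmetric : ∀ {X Y Z} (f : Hom X Y) (x u v w : Hom Z X) →
                  D (D f) ∘ ⟨ ⟨ x , u ⟩ , ⟨ v , w ⟩ ⟩ ≈
                  D (D f) ∘ ⟨ ⟨ x , v ⟩ , ⟨ u , w ⟩ ⟩

  _⁽_⁾ : ∀ {X Y} → Hom X Y → ∀ n → Hom (S[ n ] X) Y
  f ⁽ zero ⁾  = f
  f ⁽ suc n ⁾ = D (f ⁽ n ⁾) ∘
    ⟨ ⟪ (λ i → π (suc n) (inject₁ i)) ⟫
    , ⟪ π (suc n) (fromℕ (suc n)) Vector.∷ Vector.replicate n 0ₕ ⟫ ⟩

module Taylor {R : CommutativeSemiring r ℓr} (inv : HasIntegerInverses R)
              (C : CartesianDifferentialCategory R o m ℓm) where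
  open CartesianDifferentialCategory C
  open Fractions R inv public

  ν : ∀ {X} n → .{{_ : NonZero n}} → Hom (S[ n ] X) (S (S[ pred n ] X))
  ν (suc n) =
    ⟨ ⟪ (λ i → π (suc n) (inject₁ i)) ⟫
    , ⟪ (λ i → frac (suc (toℕ i)) (suc n) *ₗ π (suc n) (suc i)) ⟫ ⟩

  t : ∀ {X Y} n → Hom X Y → Hom (S[ n ] X) Y
  t zero    f = f
  t (suc n) f = D (t n f) ∘ ν (suc n)

-- The parts lie in Fin (suc n), so that they can index projections out of
-- S[ n ] X; no part exceeds n, so this loses nothing.

IsComposition : ∀ {k} n → Vec (Fin (suc n)) k → Set
IsComposition n is = All (λ i → 0 ℕ.< toℕ i) is ∧ Vec.sum (Vec.map toℕ is) ≡ n

isComposition? : ∀ {k} n (is : Vec (Fin (suc n)) k) → Dec (IsComposition n is)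
isComposition? n is =
  All.all? (λ i → 0 ℕ.<? toℕ i) is ×-dec (Vec.sum (Vec.map toℕ is) ℕ.≟ n)

words : ∀ {a} {A : Set a} k → List A → List (Vec A k)
words zero    xs = List.[ Vec.[] ]
words (suc k) xs = List.cartesianProductWith Vec._∷_ xs (words k xs)

compositions : ∀ n k → List (Vec (Fin (suc n)) k)
compositions n k = List.filter (isComposition? n) (words k (List.allFin (suc n)))

{-# OPTIONS --safe #-}

-- By the chain rule and the linearity of the higher derivatives in each
-- direction, D(-) ∘ ν (n + 1) sends the term of a composition i₁ + ⋯ + iₖ = n
-- to 1/(n + 1) times the sum of the term of that composition with a part 1
-- adjoined and of, for each j, iⱼ + 1 times its term with iⱼ incremented.
-- Conversely, a composition of n + 1 arises in the first way from removing one
-- of its parts 1, and in the second way, with weight i, from each of its parts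
-- i ≥ 2. Since f⁽ᵏ⁾ is symmetric and k · 1/k! = 1/(k − 1)!, each part i of a
-- composition of n + 1 into k parts thus contributes i/k!, in total (n + 1)/k!.

module Submission where

open import Defs
open import Level using (Level; _⊔_)
open import Algebra.Bundles using (CommutativeMonoid; CommutativeSemiring)
open import Algebra.Module.Bundles using (Semimodule)
open import Algebra.Module.Morphism.Structures using (module SemimoduleMorphisms)
import Algebra.Properties.CommutativeMonoid.Sum as CommutativeMonoidSum
import Algebra.Properties.CommutativeSemigroup as CommutativeSemigroupProperties
import Algebra.Properties.Semiring.Mult as SemiringMult
open import Data.Bool.Base using (true; false)
open import Data.Fin.Base using (Fin; zero; suc; toℕ; inject₁; fromℕ)
open import Data.Fin.Properties using (toℕ-inject₁)
open import Data.List.Base as List using (List; []; _∷_; length; applyUpTo)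
open import Data.List.Properties using (filter-≐; filter-none; filter-++)
open import Data.List.Relation.Binary.Permutation.Propositional as Perm using (_↭_; prep; swap)
open import Data.List.Relation.Unary.All as ListAll using ([]; _∷_)
open import Data.Nat.Base as ℕ using (ℕ; zero; suc; _≤_; _<_; z≤n; s≤s; z<s; s<s; _!)
open import Data.Nat.ListAction using (sum)
import Data.Nat.Properties as ℕ
open import Data.Product.Base using (_,_; ∃; proj₂) renaming (_×_ to _∧_)
open import Data.Vec.Base as Vec using (Vec; []; _∷_; lookup)
open import Data.Vec.Functional as Vector using (Vector)
open import Data.Vec.Relation.Unary.All as VecAll using ([]; _∷_)
open import Function.Base using () renaming (_∘_ to _⊙_)
open import Relation.Binary.PropositionalEquality as ≡ using (_≡_)
import Relation.Binary.Reasoning.Setoid as SetoidReasoning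
open import Relation.Nullary.Decidable.Core using (does; _×-dec_)
open import Relation.Nullary.Negation.Core using (¬_)
open import Relation.Unary using (Pred; Decidable)

-- The weights in `ν` come from a formal curve Σ πᵢ sⁱ: the i-th coefficient of its derivative is (i
-- + 1) πᵢ₊₁, and `ν (suc n)` pairs the point with 1/(n + 1) times this velocity. That the base
-- point has velocity π₁ is what adjoins a part 1. The main obstacle is that `D` acts on morphisms:
-- an equation known only at particular generalised points cannot be differentiated. Whatever an
-- induction has to differentiate is therefore available at generic arguments (`fst`, `snd`, `π`),
-- or is carried along by linear maps. Two changes of form remove bookkeeping. `S[ n ] X` nests the
-- latest direction innermost, so derivatives are computed on the oppositely nested `P k X`. And
-- incrementing a part changes the bound in `Fin (suc n)`, so compositions become plain lists of
-- naturals.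

private
  variable
    r ℓr m ℓm m′ ℓm′ : Level

-- Sums over antidiagonals, compositions and positions in a list.

module CompositionSums {R : CommutativeSemiring r ℓr} (M : Semimodule R m ℓm) where
  open Semimodule M
  open CommutativeSemigroupProperties (CommutativeMonoid.commutativeSemigroup +ᴹ-commutativeMonoid)
    using (interchange)

  antidiagonalSum : ℕ → (ℕ → ℕ → Carrierᴹ) → Carrierᴹ
  antidiagonalSum zero    G = G 0 0
  antidiagonalSum (suc n) G = G 0 (suc n) +ᴹ antidiagonalSum n (λ a b → G (suc a) b)

  antidiagonalSum-cong : ∀ n {G H} → (∀ a b → a ℕ.+ b ≡ n → G a b ≈ᴹ H a b) →
                         antidiagonalSum n G ≈ᴹ antidiagonalSum n H
  antidiagonalSum-cong zero    eq = eq 0 0 ≡.refl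
  antidiagonalSum-cong (suc n) eq = +ᴹ-cong (eq 0 (suc n) ≡.refl)
    (antidiagonalSum-cong n (λ a b a+b≡n → eq (suc a) b (≡.cong suc a+b≡n)))

  antidiagonalSum-+ : ∀ n G H → antidiagonalSum n (λ a b → G a b +ᴹ H a b) ≈ᴹ
                                antidiagonalSum n G +ᴹ antidiagonalSum n H
  antidiagonalSum-+ zero    G H = ≈ᴹ-refl
  antidiagonalSum-+ (suc n) G H =
    ≈ᴹ-trans (+ᴹ-congˡ (antidiagonalSum-+ n _ _)) (interchange _ _ _ _)

  antidiagonalSum-0 : ∀ n {G} → (∀ a b → a ℕ.+ b ≡ n → G a b ≈ᴹ 0ᴹ) → antidiagonalSum n G ≈ᴹ 0ᴹ
  antidiagonalSum-0 zero    eq = eq 0 0 ≡.refl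
  antidiagonalSum-0 (suc n) eq = ≈ᴹ-trans
    (+ᴹ-cong (eq 0 (suc n) ≡.refl)
             (antidiagonalSum-0 n (λ a b a+b≡n → eq (suc a) b (≡.cong suc a+b≡n))))
    (+ᴹ-identityˡ 0ᴹ)

  -- Isolates the term with second index 0, to which an induction hypothesis about a successor does
  -- not apply.
  antidiagonalSum-last : ∀ n G → antidiagonalSum (suc n) G ≈ᴹ
                                 antidiagonalSum n (λ a b → G a (suc b)) +ᴹ G (suc n) 0
  antidiagonalSum-last zero    G = ≈ᴹ-refl
  antidiagonalSum-last (suc n) G =
    ≈ᴹ-trans (+ᴹ-congˡ (antidiagonalSum-last n (λ a b → G (suc a) b))) (≈ᴹ-sym (+ᴹ-assoc _ _ _))

  compositionSum : ℕ → ℕ → (List ℕ → Carrierᴹ) → Carrierᴹ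
  compositionSum zero    zero    Φ = Φ []
  compositionSum zero    (suc k) Φ = 0ᴹ
  compositionSum (suc n) zero    Φ = 0ᴹ
  compositionSum (suc n) (suc k) Φ =
    antidiagonalSum n (λ a b → compositionSum b k (λ is → Φ (suc a ∷ is)))

  compositionSum-cong : ∀ n k {Φ Ψ} → (∀ is → sum is ≡ n → length is ≡ k → Φ is ≈ᴹ Ψ is) →
                        compositionSum n k Φ ≈ᴹ compositionSum n k Ψ
  compositionSum-cong zero    zero    eq = eq [] ≡.refl ≡.refl
  compositionSum-cong zero    (suc k) eq = ≈ᴹ-refl
  compositionSum-cong (suc n) zero    eq = ≈ᴹ-refl
  compositionSum-cong (suc n) (suc k) eq =
    antidiagonalSum-cong n λ a b a+b≡n →
    compositionSum-cong b k λ is sum≡b length≡k →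
    eq (suc a ∷ is)
       (≡.cong suc (≡.trans (≡.cong (a ℕ.+_) sum≡b) a+b≡n))
       (≡.cong suc length≡k)

  compositionSum-+ : ∀ n k Φ Ψ → compositionSum n k (λ is → Φ is +ᴹ Ψ is) ≈ᴹ
                                 compositionSum n k Φ +ᴹ compositionSum n k Ψ
  compositionSum-+ zero    zero    Φ Ψ = ≈ᴹ-refl
  compositionSum-+ zero    (suc k) Φ Ψ = ≈ᴹ-sym (+ᴹ-identityˡ 0ᴹ)
  compositionSum-+ (suc n) zero    Φ Ψ = ≈ᴹ-sym (+ᴹ-identityˡ 0ᴹ)
  compositionSum-+ (suc n) (suc k) Φ Ψ = ≈ᴹ-trans
    (antidiagonalSum-cong n (λ a b _ → compositionSum-+ b k _ _))
    (antidiagonalSum-+ n _ _)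

  compositionSum-0 : ∀ n k Φ → n < k → compositionSum n k Φ ≈ᴹ 0ᴹ
  compositionSum-0 zero    (suc k) Φ _         = ≈ᴹ-refl
  compositionSum-0 (suc n) (suc k) Φ (s<s n<k) = antidiagonalSum-0 n λ a b a+b≡n →
    compositionSum-0 b k _ (ℕ.≤-<-trans (ℕ.m+n≤o⇒n≤o a (ℕ.≤-reflexive a+b≡n)) n<k)

  prefixSum : ℕ → (ℕ → Carrierᴹ) → Carrierᴹ
  prefixSum zero    g = 0ᴹ
  prefixSum (suc n) g = g 0 +ᴹ prefixSum n (g ⊙ suc)

  prefixSum-cong : ∀ n {g h} → (∀ k → g k ≈ᴹ h k) → prefixSum n g ≈ᴹ prefixSum n h
  prefixSum-cong zero    eq = ≈ᴹ-refl
  prefixSum-cong (suc n) eq = +ᴹ-cong (eq 0) (prefixSum-cong n (λ k → eq (suc k)))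

  prefixSum-+ : ∀ n g h → prefixSum n (λ k → g k +ᴹ h k) ≈ᴹ prefixSum n g +ᴹ prefixSum n h
  prefixSum-+ zero    g h = ≈ᴹ-sym (+ᴹ-identityˡ 0ᴹ)
  prefixSum-+ (suc n) g h = ≈ᴹ-trans (+ᴹ-congˡ (prefixSum-+ n _ _)) (interchange _ _ _ _)

  prefixSum-last : ∀ n g → prefixSum (suc n) g ≈ᴹ prefixSum n g +ᴹ g n
  prefixSum-last zero    g = +ᴹ-comm _ _
  prefixSum-last (suc n) g =
    ≈ᴹ-trans (+ᴹ-congˡ (prefixSum-last n _)) (≈ᴹ-sym (+ᴹ-assoc _ _ _))

  -- A sum over positions and not over values, so equal parts count separately; the remaining
  -- entries keep their order.
  pickSum : (ℕ → List ℕ → Carrierᴹ) → List ℕ → Carrierᴹ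
  pickSum G []       = 0ᴹ
  pickSum G (i ∷ is) = G i is +ᴹ pickSum (λ h t → G h (i ∷ t)) is

  pickSum-cong : ∀ {G H} → (∀ h t → G h t ≈ᴹ H h t) → ∀ is → pickSum G is ≈ᴹ pickSum H is
  pickSum-cong eq []       = ≈ᴹ-refl
  pickSum-cong eq (i ∷ is) = +ᴹ-cong (eq i is) (pickSum-cong (λ h t → eq h (i ∷ t)) is)

  -- Unfolds to the same `foldr` as `∑` on hom-sets, so that its properties apply to the sums of the
  -- theorem as they stand.
  foldSum : ∀ {a} {A : Set a} → List A → (A → Carrierᴹ) → Carrierᴹ
  foldSum xs F = List.foldr (λ x s → F x +ᴹ s) 0ᴹ xs

module Homomorphism {R : CommutativeSemiring r ℓr} (M : Semimodule R m ℓm) (N : Semimodule R m′ ℓm′)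
  {φ : Semimodule.Carrierᴹ M → Semimodule.Carrierᴹ N}
  (+-homo : ∀ x y → Semimodule._≈ᴹ_ N (φ (Semimodule._+ᴹ_ M x y)) (Semimodule._+ᴹ_ N (φ x) (φ y)))
  (0-homo : Semimodule._≈ᴹ_ N (φ (Semimodule.0ᴹ M)) (Semimodule.0ᴹ N)) where
  private
    module M = CompositionSums M
    module N = CompositionSums N
  open Semimodule N

  antidiagonalSum-homo : ∀ n G → φ (M.antidiagonalSum n G) ≈ᴹ N.antidiagonalSum n (λ a b → φ (G a b))
  antidiagonalSum-homo zero    G = ≈ᴹ-refl
  antidiagonalSum-homo (suc n) G = ≈ᴹ-trans (+-homo _ _) (+ᴹ-congˡ (antidiagonalSum-homo n _))

  compositionSum-homo : ∀ n k Φ → φ (M.compositionSum n k Φ) ≈ᴹ N.compositionSum n k (φ ⊙ Φ)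
  compositionSum-homo zero    zero    Φ = ≈ᴹ-refl
  compositionSum-homo zero    (suc k) Φ = 0-homo
  compositionSum-homo (suc n) zero    Φ = 0-homo
  compositionSum-homo (suc n) (suc k) Φ = ≈ᴹ-trans (antidiagonalSum-homo n _)
    (N.antidiagonalSum-cong n (λ a b _ → compositionSum-homo b k _))

  prefixSum-homo : ∀ n g → φ (M.prefixSum n g) ≈ᴹ N.prefixSum n (φ ⊙ g)
  prefixSum-homo zero    g = 0-homo
  prefixSum-homo (suc n) g = ≈ᴹ-trans (+-homo _ _) (+ᴹ-congˡ (prefixSum-homo n _))

  pickSum-homo : ∀ G is → φ (M.pickSum G is) ≈ᴹ N.pickSum (λ h t → φ (G h t)) is
  pickSum-homo G []       = 0-homo
  pickSum-homo G (i ∷ is) = ≈ᴹ-trans (+-homo _ _) (+ᴹ-congˡ (pickSum-homo _ is))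

-- Passage from compositions of n to compositions of n + 1.

module CompositionIdentities {R : CommutativeSemiring r ℓr} (M : Semimodule R m ℓm) where
  open CommutativeSemiring R using (1#; semiring; +-identityʳ)
    renaming (Carrier to Scalar)
  open Semimodule M
  open CompositionSums M
  open SetoidReasoning ≈ᴹ-setoid
  open CommutativeSemigroupProperties (CommutativeMonoid.commutativeSemigroup +ᴹ-commutativeMonoid)
    using (interchange)
  open SemiringMult semiring using (×-homo-+)
  module Scaling (c : Scalar) = Homomorphism M M {φ = c *ₗ_} (*ₗ-distribˡ c) (*ₗ-zeroʳ c)

  fromNat-1-*ₗ : ∀ x → fromNat R 1 *ₗ x ≈ᴹ x
  fromNat-1-*ₗ x = ≈ᴹ-trans (*ₗ-congʳ (+-identityʳ 1#)) (*ₗ-identityˡ x)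

  compositionSum-sum : ∀ n k Φ → compositionSum n k (λ is → fromNat R (sum is) *ₗ Φ is) ≈ᴹ
                                 fromNat R n *ₗ compositionSum n k Φ
  compositionSum-sum n k Φ = ≈ᴹ-trans
    (compositionSum-cong n k (λ { is ≡.refl _ → ≈ᴹ-refl }))
    (≈ᴹ-sym (Scaling.compositionSum-homo (fromNat R n) n k Φ))

  Symmetric : (List ℕ → Carrierᴹ) → Set _
  Symmetric Φ = ∀ {is js} → is ↭ js → Φ is ≈ᴹ Φ js

  -- The sum over all ways of incrementing one part; the incremented part is
  -- moved to the front, which a symmetric Φ does not notice.

  incrementSum : (List ℕ → Carrierᴹ) → List ℕ → Carrierᴹ
  incrementSum Φ = pickSum (λ h t → fromNat R (suc h) *ₗ Φ (suc h ∷ t))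

  incrementSum-∷ : ∀ {Φ} → Symmetric Φ → ∀ i is →
                   incrementSum Φ (i ∷ is) ≈ᴹ
                   fromNat R (suc i) *ₗ Φ (suc i ∷ is) +ᴹ incrementSum (λ js → Φ (i ∷ js)) is
  incrementSum-∷ sym i is = +ᴹ-congˡ
    (pickSum-cong (λ h t → *ₗ-congˡ (sym (swap (suc h) i Perm.refl))) is)

  -- The share of the compositions of n + 1 with a marked part 1. The factor counts the positions of
  -- the mark, all of which look alike to a symmetric `Φ`.
  unitSum : ℕ → ℕ → (List ℕ → Carrierᴹ) → Carrierᴹ
  unitSum n zero    Φ = 0ᴹ
  unitSum n (suc k) Φ = fromNat R (suc k) *ₗ compositionSum n k (λ is → Φ (1 ∷ is))

  -- A composition of n + 1 marked at a part weighted by its size either has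
  -- a marked part 1, whose removal leaves a composition of n, or comes from
  -- a composition of n by incrementing the marked part.

  compositionSum-suc : ∀ n k {Φ} → Symmetric Φ →
                       compositionSum (suc n) k (λ is → fromNat R (sum is) *ₗ Φ is) ≈ᴹ
                       unitSum n k Φ +ᴹ compositionSum n k (incrementSum Φ)
  compositionSum-suc zero    zero    sym = ≈ᴹ-sym (+ᴹ-identityˡ 0ᴹ)
  compositionSum-suc (suc n) zero    sym = ≈ᴹ-sym (+ᴹ-identityˡ 0ᴹ)
  -- The weight of `suc a ∷ is` is `suc a` plus `sum is`: the mark sits on the first part (`head`)
  -- or on a later one (`tail`), and induction on `k` treats the latter.
  compositionSum-suc n       (suc k) {Φ} sym = begin
    antidiagonalSum n (λ a b → compositionSum b k (λ is → fromNat R (suc a ℕ.+ sum is) *ₗ Φ (suc a ∷ is)))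
      ≈⟨ antidiagonalSum-cong n (λ a b _ → split a b) ⟩
    antidiagonalSum n (λ a b → head a b +ᴹ tail a b)
      ≈⟨ antidiagonalSum-+ n head tail ⟩
    antidiagonalSum n head +ᴹ antidiagonalSum n tail
      ≈⟨ heads+tails n ⟩
    unitSum n (suc k) Φ +ᴹ compositionSum n (suc k) (incrementSum Φ)
      ∎
    where
    Φ₁ : List ℕ → Carrierᴹ
    Φ₁ is = Φ (1 ∷ is)

    head tail : ℕ → ℕ → Carrierᴹ
    head a b = fromNat R (suc a) *ₗ compositionSum b k (λ is → Φ (suc a ∷ is))
    tail a b = compositionSum b k (λ is → fromNat R (sum is) *ₗ Φ (suc a ∷ is))

    split : ∀ a b → compositionSum b k (λ is → fromNat R (suc a ℕ.+ sum is) *ₗ Φ (suc a ∷ is)) ≈ᴹ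
                    head a b +ᴹ tail a b
    split a b = begin
      compositionSum b k (λ is → fromNat R (suc a ℕ.+ sum is) *ₗ Φ (suc a ∷ is))
        ≈⟨ compositionSum-cong b k (λ is _ _ →
             ≈ᴹ-trans (*ₗ-congʳ (×-homo-+ 1# (suc a) (sum is))) (*ₗ-distribʳ _ _ _)) ⟩
      compositionSum b k (λ is → fromNat R (suc a) *ₗ Φ (suc a ∷ is) +ᴹ fromNat R (sum is) *ₗ Φ (suc a ∷ is))
        ≈⟨ compositionSum-+ b k _ _ ⟩
      compositionSum b k (λ is → fromNat R (suc a) *ₗ Φ (suc a ∷ is)) +ᴹ tail a b
        ≈⟨ +ᴹ-congʳ (Scaling.compositionSum-homo (fromNat R (suc a)) b k _) ⟨
      head a b +ᴹ tail a b
        ∎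

    -- Compositions of 0 have weight 0.
    tail-0 : ∀ a → tail a 0 ≈ᴹ 0ᴹ
    tail-0 a = ≈ᴹ-trans (compositionSum-sum 0 k _) (*ₗ-zeroˡ _)

    -- The marked 1 stands right behind the first part `suc a`; swapped to the front, it leaves
    -- `suc a ∷ is`, which runs through the compositions of `suc n`.
    unitSum-prepend : ∀ n k → antidiagonalSum n (λ a b → unitSum b k (λ is → Φ (suc a ∷ is))) ≈ᴹ
                              fromNat R k *ₗ compositionSum (suc n) k Φ₁
    unitSum-prepend n zero    = ≈ᴹ-trans (antidiagonalSum-0 n (λ _ _ _ → ≈ᴹ-refl)) (≈ᴹ-sym (*ₗ-zeroʳ _))
    unitSum-prepend n (suc k) = ≈ᴹ-trans
      (≈ᴹ-sym (Scaling.antidiagonalSum-homo (fromNat R (suc k)) n _))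
      (*ₗ-congˡ (antidiagonalSum-cong n λ a b _ → compositionSum-cong b k λ is _ _ →
        sym (swap (suc a) 1 Perm.refl)))

    -- One position of the mark is the first, accounted for by `head 0`; the other `k` come from the
    -- tails.
    unitSum-expand : ∀ n → unitSum n (suc k) Φ ≈ᴹ compositionSum n k Φ₁ +ᴹ fromNat R k *ₗ compositionSum n k Φ₁
    unitSum-expand n = ≈ᴹ-trans (*ₗ-distribʳ _ _ _) (+ᴹ-congʳ (*ₗ-identityˡ _))

    heads+tails : ∀ n → antidiagonalSum n head +ᴹ antidiagonalSum n tail ≈ᴹ
                        unitSum n (suc k) Φ +ᴹ compositionSum n (suc k) (incrementSum Φ)
    heads+tails zero = begin
      head 0 0 +ᴹ tail 0 0                                                    ≈⟨ +ᴹ-congˡ (tail-0 0) ⟩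
      head 0 0 +ᴹ 0ᴹ                                                          ≈⟨ +ᴹ-congʳ (fromNat-1-*ₗ _) ⟩
      compositionSum 0 k Φ₁ +ᴹ 0ᴹ                                             ≈⟨ +ᴹ-congʳ (vanish k) ⟨
      (compositionSum 0 k Φ₁ +ᴹ fromNat R k *ₗ compositionSum 0 k Φ₁) +ᴹ 0ᴹ   ≈⟨ +ᴹ-congʳ (unitSum-expand 0) ⟨
      unitSum 0 (suc k) Φ +ᴹ 0ᴹ                                               ∎
      where
      vanish : ∀ k → compositionSum 0 k Φ₁ +ᴹ fromNat R k *ₗ compositionSum 0 k Φ₁ ≈ᴹ compositionSum 0 k Φ₁
      vanish zero    = ≈ᴹ-trans (+ᴹ-congˡ (*ₗ-zeroˡ _)) (+ᴹ-identityʳ _)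
      vanish (suc k) = ≈ᴹ-trans (+ᴹ-congˡ (*ₗ-zeroʳ _)) (+ᴹ-identityʳ _)
    heads+tails (suc n) = begin
      antidiagonalSum (suc n) head +ᴹ antidiagonalSum (suc n) tail
        -- The term `a = 0` of `head` is a marked first part 1; its other terms have a marked first
        -- part of at least 2 and are the increments of a first part.
        ≈⟨ +ᴹ-cong (+ᴹ-congʳ (fromNat-1-*ₗ _))
             (≈ᴹ-trans (antidiagonalSum-last n tail)
             (≈ᴹ-trans (+ᴹ-congˡ (tail-0 (suc n))) (+ᴹ-identityʳ _))) ⟩
      (A +ᴹ antidiagonalSum n headₛ) +ᴹ antidiagonalSum n (λ a b → tail a (suc b))
        ≈⟨ +ᴹ-congˡ (antidiagonalSum-cong n (λ a b _ → compositionSum-suc b k (λ p → sym (prep (suc a) p)))) ⟩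
      (A +ᴹ antidiagonalSum n headₛ) +ᴹ
      antidiagonalSum n (λ a b → unitSum b k (λ is → Φ (suc a ∷ is)) +ᴹ tailₛ a b)
        ≈⟨ +ᴹ-congˡ (≈ᴹ-trans (antidiagonalSum-+ n _ _) (+ᴹ-congʳ (unitSum-prepend n k))) ⟩
      (A +ᴹ antidiagonalSum n headₛ) +ᴹ (B +ᴹ antidiagonalSum n tailₛ)
        ≈⟨ interchange _ _ _ _ ⟩
      (A +ᴹ B) +ᴹ (antidiagonalSum n headₛ +ᴹ antidiagonalSum n tailₛ)
        ≈⟨ +ᴹ-cong (unitSum-expand (suc n)) (antidiagonalSum-+ n headₛ tailₛ) ⟨
      unitSum (suc n) (suc k) Φ +ᴹ antidiagonalSum n (λ a b → headₛ a b +ᴹ tailₛ a b)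
        ≈⟨ +ᴹ-congˡ (antidiagonalSum-cong n λ a b _ → merge a b) ⟩
      unitSum (suc n) (suc k) Φ +ᴹ compositionSum (suc n) (suc k) (incrementSum Φ)
        ∎
      where
      A B : Carrierᴹ
      A = compositionSum (suc n) k Φ₁
      B = fromNat R k *ₗ compositionSum (suc n) k Φ₁

      headₛ tailₛ : ℕ → ℕ → Carrierᴹ
      headₛ a b = head (suc a) b
      tailₛ a b = compositionSum b k (incrementSum (λ is → Φ (suc a ∷ is)))

      merge : ∀ a b → headₛ a b +ᴹ tailₛ a b ≈ᴹ compositionSum b k (λ is → incrementSum Φ (suc a ∷ is))
      merge a b = begin
        headₛ a b +ᴹ tailₛ a b
          ≈⟨ +ᴹ-congʳ (Scaling.compositionSum-homo (fromNat R (suc (suc a))) b k _) ⟩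
        compositionSum b k (λ is → fromNat R (suc (suc a)) *ₗ Φ (suc (suc a) ∷ is)) +ᴹ tailₛ a b
          ≈⟨ compositionSum-+ b k _ _ ⟨
        compositionSum b k (λ is → fromNat R (suc (suc a)) *ₗ Φ (suc (suc a) ∷ is) +ᴹ
                                   incrementSum (λ js → Φ (suc a ∷ js)) is)
          ≈⟨ compositionSum-cong b k (λ is _ _ → incrementSum-∷ sym (suc a) is) ⟨
        compositionSum b k (λ is → incrementSum Φ (suc a ∷ is))
          ∎

-- Sums over compositions weighted by inverse factorials.

module ExponentialSums {R : CommutativeSemiring r ℓr} (inv : HasIntegerInverses R) (M : Semimodule R m ℓm) where
  open CommutativeSemiring R using (1#; _*_; *-comm; *-assoc; *-identityʳ; *-identityˡ; *-congˡ; *-congʳ; semiring; setoid)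
    renaming (_≈_ to _≃_; trans to ≃-trans)
  open Fractions R inv
  open Semimodule M
  open CompositionSums M
  open CompositionIdentities M

  1/-inverse : ∀ n → .{{_ : ℕ.NonZero n}} → 1/ n * fromNat R n ≃ 1#
  1/-inverse n = proj₂ (inv n)

  -- `1/fact (suc k)` is the inverse supplied for one number, not a product of supplied inverses.
  -- The two sides agree because inverses are unique: both invert `k !`.
  1/fact-suc : ∀ k → 1/fact (suc k) * fromNat R (suc k) ≃ 1/fact k
  1/fact-suc k = begin
    1/fact (suc k) * fromNat R (suc k)                                       ≈⟨ *-identityʳ _ ⟨
    1/fact (suc k) * fromNat R (suc k) * 1#                                  ≈⟨ *-congˡ (≃-trans (*-comm _ _) (1/-inverse (k !) {{k ℕ.!≢0}})) ⟨
    1/fact (suc k) * fromNat R (suc k) * (fromNat R (k !) * 1/fact k)        ≈⟨ *-assoc _ _ _ ⟨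
    1/fact (suc k) * fromNat R (suc k) * fromNat R (k !) * 1/fact k          ≈⟨ *-congʳ (*-assoc _ _ _) ⟩
    1/fact (suc k) * (fromNat R (suc k) * fromNat R (k !)) * 1/fact k        ≈⟨ *-congʳ (*-congˡ (SemiringMult.×1-homo-* semiring (suc k) (k !))) ⟨
    1/fact (suc k) * fromNat R (suc k !) * 1/fact k                          ≈⟨ *-congʳ (1/-inverse (suc k !) {{suc k ℕ.!≢0}}) ⟩
    1# * 1/fact k                                                            ≈⟨ *-identityˡ _ ⟩
    1/fact k                                                                 ∎
    where open SetoidReasoning setoid

  open SetoidReasoning ≈ᴹ-setoid

  expTerm : ℕ → (List ℕ → Carrierᴹ) → ℕ → Carrierᴹ
  expTerm n Φ k = 1/fact k *ₗ compositionSum n k Φ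

  -- For scalar values `Φ is` that are products of cᵢ over the parts i, this is the coefficient of
  -- xⁿ in exp(Σ cᵢ xⁱ), i ≥ 1.
  expSum : ℕ → (List ℕ → Carrierᴹ) → Carrierᴹ
  expSum n Φ = prefixSum (suc n) (expTerm n Φ)

  expSum-cong : ∀ n {Φ Ψ} → (∀ is → sum is ≡ n → Φ is ≈ᴹ Ψ is) → expSum n Φ ≈ᴹ expSum n Ψ
  expSum-cong n {Φ} {Ψ} eq = prefixSum-cong (suc n) {expTerm n Φ} {expTerm n Ψ}
    λ k → *ₗ-congˡ (compositionSum-cong n k (λ is p _ → eq is p))

  expSum-+ : ∀ n Φ Ψ → expSum n (λ is → Φ is +ᴹ Ψ is) ≈ᴹ expSum n Φ +ᴹ expSum n Ψ
  expSum-+ n Φ Ψ = ≈ᴹ-trans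
    (prefixSum-cong (suc n) {expTerm n _} λ k → ≈ᴹ-trans (*ₗ-congˡ (compositionSum-+ n k Φ Ψ)) (*ₗ-distribˡ _ _ _))
    (prefixSum-+ (suc n) (expTerm n Φ) (expTerm n Ψ))

  -- Insert `1/ suc n * fromNat R (suc n)` and read the second factor as the sum of the parts, so
  -- that `compositionSum-suc` applies. Both resulting ranges of k are one too long: the marked
  -- parts 1 vanish at k = 0 and shift down by one, the increments vanish at k = n + 1.
  expSum-suc : ∀ n {Φ} → Symmetric Φ →
               expSum (suc n) Φ ≈ᴹ 1/ suc n *ₗ expSum n (λ is → Φ (1 ∷ is) +ᴹ incrementSum Φ is)
  expSum-suc n {Φ} sym = begin
    prefixSum (2 ℕ.+ n) (expTerm (suc n) Φ)
      ≈⟨ prefixSum-cong (2 ℕ.+ n) {expTerm (suc n) Φ} term ⟩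
    prefixSum (2 ℕ.+ n) (λ k → 1/ suc n *ₗ (unitTerm k +ᴹ expTerm n Φ⁺ k))
      ≈⟨ Scaling.prefixSum-homo (1/ suc n) (2 ℕ.+ n) (λ k → unitTerm k +ᴹ expTerm n Φ⁺ k) ⟨
    1/ suc n *ₗ prefixSum (2 ℕ.+ n) (λ k → unitTerm k +ᴹ expTerm n Φ⁺ k)
      ≈⟨ *ₗ-congˡ (prefixSum-+ (2 ℕ.+ n) unitTerm (expTerm n Φ⁺)) ⟩
    1/ suc n *ₗ (prefixSum (2 ℕ.+ n) unitTerm +ᴹ
                 prefixSum (2 ℕ.+ n) (expTerm n Φ⁺))
      ≈⟨ *ₗ-congˡ (+ᴹ-cong units increments) ⟩
    1/ suc n *ₗ (expSum n (λ is → Φ (1 ∷ is)) +ᴹ expSum n Φ⁺)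
      ≈⟨ *ₗ-congˡ (expSum-+ n _ _) ⟨
    1/ suc n *ₗ expSum n (λ is → Φ (1 ∷ is) +ᴹ Φ⁺ is)
      ∎
    where
    Φ⁺ : List ℕ → Carrierᴹ
    Φ⁺ = incrementSum Φ

    unitTerm : ℕ → Carrierᴹ
    unitTerm k = 1/fact k *ₗ unitSum n k Φ

    term : ∀ k → 1/fact k *ₗ compositionSum (suc n) k Φ ≈ᴹ
                 1/ suc n *ₗ (unitTerm k +ᴹ expTerm n Φ⁺ k)
    term k = begin
      1/fact k *ₗ compositionSum (suc n) k Φ
        ≈⟨ *ₗ-congˡ (≈ᴹ-trans (*ₗ-congʳ (1/-inverse (suc n))) (*ₗ-identityˡ _)) ⟨
      1/fact k *ₗ (1/ suc n * fromNat R (suc n)) *ₗ compositionSum (suc n) k Φ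
        ≈⟨ *ₗ-congˡ (*ₗ-assoc _ _ _) ⟩
      1/fact k *ₗ 1/ suc n *ₗ fromNat R (suc n) *ₗ compositionSum (suc n) k Φ
        ≈⟨ *ₗ-comm _ _ _ ⟩
      1/ suc n *ₗ 1/fact k *ₗ fromNat R (suc n) *ₗ compositionSum (suc n) k Φ
        ≈⟨ *ₗ-congˡ (*ₗ-congˡ (≈ᴹ-trans (≈ᴹ-sym (compositionSum-sum (suc n) k Φ)) (compositionSum-suc n k sym))) ⟩
      1/ suc n *ₗ 1/fact k *ₗ (unitSum n k Φ +ᴹ compositionSum n k Φ⁺)
        ≈⟨ *ₗ-congˡ (*ₗ-distribˡ _ _ _) ⟩
      1/ suc n *ₗ (unitTerm k +ᴹ expTerm n Φ⁺ k)
        ∎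

    units : prefixSum (2 ℕ.+ n) unitTerm ≈ᴹ expSum n (λ is → Φ (1 ∷ is))
    units = ≈ᴹ-trans (+ᴹ-cong (*ₗ-zeroʳ _)
      (prefixSum-cong (suc n) {unitTerm ⊙ suc} {expTerm n (λ is → Φ (1 ∷ is))} λ k → ≈ᴹ-trans (≈ᴹ-sym (*ₗ-assoc _ _ _)) (*ₗ-congʳ (1/fact-suc k))))
      (+ᴹ-identityˡ _)

    increments : prefixSum (2 ℕ.+ n) (expTerm n Φ⁺) ≈ᴹ expSum n Φ⁺
    increments = ≈ᴹ-trans (prefixSum-last (suc n) (expTerm n Φ⁺)) (≈ᴹ-trans
      (+ᴹ-congˡ (≈ᴹ-trans (*ₗ-congˡ (compositionSum-0 n (suc n) Φ⁺ (ℕ.n<1+n n))) (*ₗ-zeroʳ _)))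
      (+ᴹ-identityʳ _))

  foldSum-applyUpTo : ∀ {a} {A : Set a} (g : ℕ → A) n F →
                      foldSum (List.applyUpTo g n) F ≡ prefixSum n (F ⊙ g)
  foldSum-applyUpTo g zero    F = ≡.refl
  foldSum-applyUpTo g (suc n) F = ≡.cong (F (g 0) +ᴹ_) (foldSum-applyUpTo (g ⊙ suc) n F)

  -- The term k = 0 drops out because a positive number has no composition without parts. For 0 the
  -- empty composition would survive, which is why the theorem starts at n = 1.
  expSum-suc-foldSum : ∀ n {Φ F} → (∀ k → F k ≈ᴹ expTerm (suc n) Φ k) →
                       expSum (suc n) Φ ≈ᴹ foldSum (List.applyUpTo suc (suc n)) F
  expSum-suc-foldSum n {Φ} {F} eq = begin
    expTerm (suc n) Φ 0 +ᴹ prefixSum (suc n) (expTerm (suc n) Φ ⊙ suc)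
      ≈⟨ ≈ᴹ-trans (+ᴹ-congʳ (*ₗ-zeroʳ _)) (+ᴹ-identityˡ _) ⟩
    prefixSum (suc n) (expTerm (suc n) Φ ⊙ suc)
      ≈⟨ prefixSum-cong (suc n) {F ⊙ suc} {expTerm (suc n) Φ ⊙ suc} (λ k → eq (suc k)) ⟨
    prefixSum (suc n) (F ⊙ suc)
      ≡⟨ foldSum-applyUpTo suc (suc n) F ⟨
    foldSum (List.applyUpTo suc (suc n)) F
      ∎

module ExpHomomorphism {R : CommutativeSemiring r ℓr} (inv : HasIntegerInverses R)
  (M : Semimodule R m ℓm) (N : Semimodule R m′ ℓm′)
  {φ : Semimodule.Carrierᴹ M → Semimodule.Carrierᴹ N}
  (+-homo : ∀ x y → Semimodule._≈ᴹ_ N (φ (Semimodule._+ᴹ_ M x y)) (Semimodule._+ᴹ_ N (φ x) (φ y)))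
  (0-homo : Semimodule._≈ᴹ_ N (φ (Semimodule.0ᴹ M)) (Semimodule.0ᴹ N))
  (*-homo : ∀ c x → Semimodule._≈ᴹ_ N (φ (Semimodule._*ₗ_ M c x)) (Semimodule._*ₗ_ N c (φ x))) where
  private
    module M = ExponentialSums inv M
    module N = ExponentialSums inv N
  open Semimodule N
  open CompositionSums N using (prefixSum-cong)
  open Homomorphism M N {φ = φ} +-homo 0-homo

  expSum-homo : ∀ n Φ → φ (M.expSum n Φ) ≈ᴹ N.expSum n (φ ⊙ Φ)
  expSum-homo n Φ = ≈ᴹ-trans (prefixSum-homo (suc n) (M.expTerm n Φ))
    (prefixSum-cong (suc n) {φ ⊙ M.expTerm n Φ} {N.expTerm n (φ ⊙ Φ)} λ k →
      ≈ᴹ-trans (*-homo _ _) (*ₗ-congˡ (compositionSum-homo n k Φ)))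

-- IsComposition with a part v split off and with the bound on the parts
-- decoupled from n.

Completes : ∀ {N k} → ℕ → ℕ → Vec (Fin N) k → Set
Completes v n is = VecAll.All (λ i → 0 < toℕ i) is ∧ v ℕ.+ Vec.sum (Vec.map toℕ is) ≡ n

completes? : ∀ {N k} v n → Decidable (Completes {N} {k} v n)
completes? v n is = VecAll.all? (λ i → 0 ℕ.<? toℕ i) is ×-dec (v ℕ.+ Vec.sum (Vec.map toℕ is) ℕ.≟ n)

parts : ∀ {N k} → Vec (Fin N) k → List ℕ
parts is = Vec.toList (Vec.map toℕ is)

-- The filtered words enumerate the compositions.

module CompositionEnumeration {R : CommutativeSemiring r ℓr} (M : Semimodule R m ℓm) where
  open Semimodule M
  open CompositionSums M
  open SetoidReasoning ≈ᴹ-setoid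

  foldSum-cong : ∀ {a} {A : Set a} {F G : A → Carrierᴹ} → (∀ x → F x ≈ᴹ G x) →
                 ∀ xs → foldSum xs F ≈ᴹ foldSum xs G
  foldSum-cong eq []       = ≈ᴹ-refl
  foldSum-cong eq (x ∷ xs) = +ᴹ-cong (eq x) (foldSum-cong eq xs)

  foldSum-++ : ∀ {a} {A : Set a} xs ys (F : A → Carrierᴹ) →
               foldSum (xs List.++ ys) F ≈ᴹ foldSum xs F +ᴹ foldSum ys F
  foldSum-++ []       ys F = ≈ᴹ-sym (+ᴹ-identityˡ _)
  foldSum-++ (x ∷ xs) ys F = ≈ᴹ-trans (+ᴹ-congˡ (foldSum-++ xs ys F)) (≈ᴹ-sym (+ᴹ-assoc _ _ _))

  foldSum-filter-none : ∀ {a p} {A : Set a} {P : Pred A p} (P? : Decidable P) →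
                        (∀ x → ¬ P x) → ∀ xs F → foldSum (List.filter P? xs) F ≈ᴹ 0ᴹ
  foldSum-filter-none P? ¬P xs F =
    ≈ᴹ-reflexive (≡.cong (λ ys → foldSum ys F) (filter-none P? (ListAll.universal ¬P xs)))

  foldSum-filter-map : ∀ {a b p} {A : Set a} {B : Set b} {P : Pred B p} (P? : Decidable P)
                       (f : A → B) xs F → foldSum (List.filter P? (List.map f xs)) F ≈ᴹ
                                          foldSum (List.filter (P? ⊙ f) xs) (F ⊙ f)
  foldSum-filter-map P? f []       F = ≈ᴹ-refl
  foldSum-filter-map P? f (x ∷ xs) F with does (P? (f x))
  ... | true  = +ᴹ-congˡ (foldSum-filter-map P? f xs F)
  ... | false = foldSum-filter-map P? f xs F

  foldSum-filter-product : ∀ {a b c p} {A : Set a} {B : Set b} {C : Set c} {P : Pred C p}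
                           (P? : Decidable P) (f : A → B → C) xs ys F →
                           foldSum (List.filter P? (List.cartesianProductWith f xs ys)) F ≈ᴹ
                           foldSum xs (λ x → foldSum (List.filter (P? ⊙ f x) ys) (F ⊙ f x))
  foldSum-filter-product P? f []       ys F = ≈ᴹ-refl
  foldSum-filter-product P? f (x ∷ xs) ys F = begin
    foldSum (List.filter P? (List.map (f x) ys List.++ rest)) F
      ≈⟨ ≈ᴹ-reflexive (≡.cong (λ zs → foldSum zs F) (filter-++ P? (List.map (f x) ys) rest)) ⟩
    foldSum (List.filter P? (List.map (f x) ys) List.++ List.filter P? rest) F
      ≈⟨ foldSum-++ (List.filter P? (List.map (f x) ys)) _ F ⟩
    foldSum (List.filter P? (List.map (f x) ys)) F +ᴹ foldSum (List.filter P? rest) F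
      ≈⟨ +ᴹ-cong (foldSum-filter-map P? (f x) ys F) (foldSum-filter-product P? f xs ys F) ⟩
    foldSum (List.filter (P? ⊙ f x) ys) (F ⊙ f x) +ᴹ
    foldSum xs (λ x → foldSum (List.filter (P? ⊙ f x) ys) (F ⊙ f x))
      ∎
    where rest = List.cartesianProductWith f xs ys

  -- `G a (n - a)`, and 0 once `a` exceeds `n`. The first part of a word ranges over all of `Fin N`,
  -- and the values that are too large admit no completion.
  antidiagonalTerm : ℕ → ℕ → (ℕ → ℕ → Carrierᴹ) → Carrierᴹ
  antidiagonalTerm n       zero    G = G 0 n
  antidiagonalTerm zero    (suc a) G = 0ᴹ
  antidiagonalTerm (suc n) (suc a) G = antidiagonalTerm n a (G ⊙ suc)

  foldSum-tabulate : ∀ N n {a} {A : Set a} (f : Fin N → A) {F : A → Carrierᴹ} G → n < N →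
                     (∀ i → F (f i) ≈ᴹ antidiagonalTerm n (toℕ i) G) →
                     foldSum (List.tabulate f) F ≈ᴹ antidiagonalSum n G
  foldSum-tabulate (suc N) zero    f G _         eq =
    ≈ᴹ-trans (+ᴹ-cong (eq zero) (zeros (f ⊙ suc) (eq ⊙ suc))) (+ᴹ-identityʳ _)
    where
    zeros : ∀ {N a} {A : Set a} (f : Fin N → A) {F : A → Carrierᴹ} → (∀ i → F (f i) ≈ᴹ 0ᴹ) →
            foldSum (List.tabulate f) F ≈ᴹ 0ᴹ
    zeros {zero}  f eq = ≈ᴹ-refl
    zeros {suc N} f eq = ≈ᴹ-trans (+ᴹ-cong (eq zero) (zeros (f ⊙ suc) (eq ⊙ suc))) (+ᴹ-identityˡ _)
  foldSum-tabulate (suc N) (suc n) f G (s<s n<N) eq =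
    +ᴹ-cong (eq zero) (foldSum-tabulate N n (f ⊙ suc) (G ⊙ suc) n<N (eq ⊙ suc))

  -- Strips `v` by single units from both sides of the equation for the sum, ending with the
  -- remainder `n - v` or, if `v` exceeds `n`, with an impossible equation.
  foldSum-completes : ∀ {N k} v n (ws : List (Vec (Fin N) k)) F E →
                      (∀ b → b ≤ n → foldSum (List.filter (completes? 0 b) ws) F ≈ᴹ E v b) →
                      foldSum (List.filter (completes? v n) ws) F ≈ᴹ antidiagonalTerm n v E
  foldSum-completes zero    n       ws F E eq = eq n ℕ.≤-refl
  foldSum-completes (suc v) zero    ws F E eq = foldSum-filter-none (completes? (suc v) 0) (λ { _ (_ , ()) }) ws F
  foldSum-completes (suc v) (suc n) ws F E eq = ≈ᴹ-trans
    (≈ᴹ-reflexive (≡.cong (λ ys → foldSum ys F)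
      (filter-≐ (completes? (suc v) (suc n)) (completes? v n)
        ( (λ (pos , eq) → pos , ℕ.suc-injective eq) , (λ (pos , eq) → pos , ≡.cong suc eq)) ws)))
    (foldSum-completes v n ws F (E ⊙ suc) (λ b b≤n → eq b (ℕ.m≤n⇒m≤1+n b≤n)))

  -- Removing the first part lowers `n` but not the alphabet, so `N` stays fixed in the induction
  -- and is only required to exceed `n`.
  foldSum-words : ∀ N n k Φ → n < N →
                  foldSum (List.filter (completes? 0 n) (words k (List.allFin N))) (Φ ⊙ parts) ≈ᴹ
                  compositionSum n k Φ
  foldSum-words N       zero    zero    Φ _ = +ᴹ-identityʳ _
  foldSum-words N       (suc n) zero    Φ _ = ≈ᴹ-refl
  foldSum-words (suc N) zero    (suc k) Φ _ =
    foldSum-filter-none (completes? 0 0) no-parts (words (suc k) (List.allFin (suc N))) _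
    where
    no-parts : ∀ is → ¬ Completes {suc N} {suc k} 0 0 is
    no-parts (zero  ∷ is) (() ∷ _ , _)
    no-parts (suc i ∷ is) (_ , ())
  foldSum-words (suc N) (suc n) (suc k) Φ (s<s n<N) = begin
    foldSum (List.filter (completes? 0 (suc n)) (words (suc k) (List.allFin (suc N)))) (Φ ⊙ parts)
      ≈⟨ foldSum-filter-product (completes? 0 (suc n)) _∷_ (List.allFin (suc N)) ws (Φ ⊙ parts) ⟩
    row zero +ᴹ foldSum (List.tabulate {n = N} suc) row
      ≈⟨ +ᴹ-cong (foldSum-filter-none (completes? 0 (suc n) ⊙ (zero ∷_)) (λ { _ (() ∷ _ , _) }) ws _)
                 (foldSum-tabulate N n suc E n<N rows) ⟩
    0ᴹ +ᴹ antidiagonalSum n E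
      ≈⟨ +ᴹ-identityˡ _ ⟩
    antidiagonalSum n E
      ∎
    where
    ws : List (Vec (Fin (suc N)) k)
    ws = words k (List.allFin (suc N))

    row : Fin (suc N) → Carrierᴹ
    row i = foldSum (List.filter (completes? 0 (suc n) ⊙ (i ∷_)) ws) (λ is → Φ (toℕ i ∷ parts is))

    E : ℕ → ℕ → Carrierᴹ
    E a b = compositionSum b k (λ is → Φ (suc a ∷ is))

    rows : ∀ i → row (suc i) ≈ᴹ antidiagonalTerm n (toℕ i) E
    rows i = ≈ᴹ-trans
      (≈ᴹ-reflexive (≡.cong (λ ys → foldSum ys (λ is → Φ (suc (toℕ i) ∷ parts is)))
        (filter-≐ (completes? 0 (suc n) ⊙ (suc i ∷_)) (completes? (toℕ i) n)
          ( (λ { (_ ∷ pos , eq) → pos , ℕ.suc-injective eq })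
          , (λ { (pos , eq) → z<s ∷ pos , ≡.cong suc eq })) ws)))
      (foldSum-completes (toℕ i) n ws _ E λ b b≤n →
        foldSum-words (suc N) b k (λ is → Φ (suc (toℕ i) ∷ is)) (s<s (ℕ.≤-trans b≤n (ℕ.<⇒≤ n<N))))

  -- `isComposition? n` is `completes? 0 n` by definition, as `0 ℕ.+ s` reduces to `s`.
  foldSum-compositions : ∀ n k Φ → foldSum (compositions n k) (Φ ⊙ parts) ≈ᴹ compositionSum n k Φ
  foldSum-compositions n k Φ = foldSum-words (suc n) n k Φ (ℕ.n<1+n n)

-- Rules of differentiation and linear morphisms.

module DifferentialCalculus {r ℓr o m ℓm} {R : CommutativeSemiring r ℓr}
                            (C : CartesianDifferentialCategory R o m ℓm) where
  open CartesianDifferentialCategory C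

  module Homs {X Y} = Semimodule (hom X Y)
  open Homs using ()
    renaming (≈ᴹ-refl to refl; ≈ᴹ-sym to sym; ≈ᴹ-trans to trans; +ᴹ-cong to +-cong;
              +ᴹ-congˡ to +-congˡ; +ᴹ-congʳ to +-congʳ; *ₗ-congˡ to *-congˡ)
  module Additive = SemimoduleMorphisms.IsSemimoduleHomomorphism
  module HomSum {X Y} = CommutativeMonoidSum (Homs.+ᴹ-commutativeMonoid {X} {Y})
  open HomSum using () renaming (sum to sumₕ)

  private
    variable
      W X Y Z : Obj

  module ≈-Reasoning {X Y} = SetoidReasoning (Homs.≈ᴹ-setoid {X} {Y})
  open ≈-Reasoning

  ∘-congˡ : ∀ {g : Hom Y Z} {f f′ : Hom X Y} → f ≈ f′ → g ∘ f ≈ g ∘ f′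
  ∘-congˡ = ∘-cong refl

  ∘-congʳ : ∀ {g g′ : Hom Y Z} {f : Hom X Y} → g ≈ g′ → g ∘ f ≈ g′ ∘ f
  ∘-congʳ eq = ∘-cong eq refl

  +-∘ : ∀ (g g′ : Hom Y Z) (f : Hom X Y) → (g + g′) ∘ f ≈ g ∘ f + g′ ∘ f
  +-∘ g g′ f = Additive.+ᴹ-homo (precomposition-additive f) g g′

  0-∘ : ∀ (f : Hom X Y) → 0ₕ {Y} {Z} ∘ f ≈ 0ₕ
  0-∘ f = Additive.0ᴹ-homo (precomposition-additive f)

  *-∘ : ∀ c (g : Hom Y Z) (f : Hom X Y) → (c *ₗ g) ∘ f ≈ c *ₗ (g ∘ f)
  *-∘ c g f = Additive.*ₗ-homo (precomposition-additive f) c g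

  ⟨⟩-cong : ∀ {f f′ : Hom Z X} {g g′ : Hom Z Y} → f ≈ f′ → g ≈ g′ → ⟨ f , g ⟩ ≈ ⟨ f′ , g′ ⟩
  ⟨⟩-cong p q = ⟨,⟩-unique (trans (fst-⟨,⟩ _ _) (sym p)) (trans (snd-⟨,⟩ _ _) (sym q))

  ⟨⟩-∘ : ∀ (f : Hom Z X) (g : Hom Z Y) (h : Hom W Z) → ⟨ f , g ⟩ ∘ h ≈ ⟨ f ∘ h , g ∘ h ⟩
  ⟨⟩-∘ f g h = sym (⟨,⟩-unique (trans (sym (assoc _ _ _)) (∘-congʳ (fst-⟨,⟩ f g)))
                               (trans (sym (assoc _ _ _)) (∘-congʳ (snd-⟨,⟩ f g))))

  ⟨⟩-η : ∀ (h : Hom Z (X × Y)) → ⟨ fst ∘ h , snd ∘ h ⟩ ≈ h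
  ⟨⟩-η h = ⟨,⟩-unique refl refl

  ⟨⟩-+ : ∀ (f f′ : Hom Z X) (g g′ : Hom Z Y) → ⟨ f , g ⟩ + ⟨ f′ , g′ ⟩ ≈ ⟨ f + f′ , g + g′ ⟩
  ⟨⟩-+ f f′ g g′ = sym (⟨,⟩-unique
    (trans (Additive.+ᴹ-homo fst-additive _ _) (+-cong (fst-⟨,⟩ _ _) (fst-⟨,⟩ _ _)))
    (trans (Additive.+ᴹ-homo snd-additive _ _) (+-cong (snd-⟨,⟩ _ _) (snd-⟨,⟩ _ _))))

  ⟨0,0⟩ : ⟨ 0ₕ {Z} {X} , 0ₕ {Z} {Y} ⟩ ≈ 0ₕ
  ⟨0,0⟩ = ⟨,⟩-unique (Additive.0ᴹ-homo fst-additive) (Additive.0ᴹ-homo snd-additive)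

  ∘fst-⟨⟩ : ∀ (h : Hom X W) (f : Hom Z X) (g : Hom Z Y) → (h ∘ fst) ∘ ⟨ f , g ⟩ ≈ h ∘ f
  ∘fst-⟨⟩ h f g = trans (assoc _ _ _) (∘-congˡ (fst-⟨,⟩ f g))

  ∘snd-⟨⟩ : ∀ (h : Hom Y W) (f : Hom Z X) (g : Hom Z Y) → (h ∘ snd) ∘ ⟨ f , g ⟩ ≈ h ∘ g
  ∘snd-⟨⟩ h f g = trans (assoc _ _ _) (∘-congˡ (snd-⟨,⟩ f g))

  sum-cong : ∀ {n} {F G : Vector (Hom X Y) n} → (∀ j → F j ≈ G j) → sumₕ F ≈ sumₕ G
  sum-cong = HomSum.sum-cong-≋

  sum-homo : ∀ {φ : Hom W X → Hom Y Z} → (∀ f g → φ (f + g) ≈ φ f + φ g) → φ 0ₕ ≈ 0ₕ →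
          ∀ {n} (F : Vector (Hom W X) n) → φ (sumₕ F) ≈ sumₕ (φ ⊙ F)
  sum-homo +-homo 0-homo {zero}  F = 0-homo
  sum-homo +-homo 0-homo {suc n} F = trans (+-homo _ _) (+-congˡ (sum-homo +-homo 0-homo (F ⊙ suc)))

  D-cong : ∀ {f g : Hom X Y} → f ≈ g → D f ≈ D g
  D-cong = Additive.⟦⟧-cong D-additive

  -- Linearity in the differential sense: the derivative at every point is the map itself. Through
  -- `D-additive₂` it implies compatibility with 0 and with scalars.
  Linear : Hom X Y → Set _
  Linear h = D h ≈ h ∘ snd

  D-fst : Linear (fst {X} {Y})
  D-fst {X} {Y} = D-proj {1} (X Vector.∷ λ _ → Y) zero

  D-snd : Linear (snd {X} {Y})
  D-snd {X} {Y} = trans (D-cong (sym (identityˡ snd)))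
    (trans (D-proj {1} (X Vector.∷ λ _ → Y) (suc zero)) (∘-congʳ (identityˡ snd)))

  linear-id : Linear (id {X})
  linear-id = trans D-id (sym (identityˡ snd))

  linear-0 : Linear (0ₕ {X} {Y})
  linear-0 = trans (Additive.0ᴹ-homo D-additive) (sym (0-∘ snd))

  D-∘-linear : ∀ (g : Hom Y Z) {h : Hom X Y} → Linear h → ∀ (p q : Hom W X) →
               D (g ∘ h) ∘ ⟨ p , q ⟩ ≈ D g ∘ ⟨ h ∘ p , h ∘ q ⟩
  D-∘-linear g {h} lin p q = begin
    D (g ∘ h) ∘ ⟨ p , q ⟩                       ≈⟨ ∘-congʳ (trans (D-∘ g h) (∘-congˡ (⟨⟩-cong refl lin))) ⟩
    (D g ∘ ⟨ h ∘ fst , h ∘ snd ⟩) ∘ ⟨ p , q ⟩   ≈⟨ assoc _ _ _ ⟩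
    D g ∘ ⟨ h ∘ fst , h ∘ snd ⟩ ∘ ⟨ p , q ⟩     ≈⟨ ∘-congˡ (⟨⟩-∘ _ _ _) ⟩
    D g ∘ ⟨ (h ∘ fst) ∘ ⟨ p , q ⟩ , (h ∘ snd) ∘ ⟨ p , q ⟩ ⟩
      ≈⟨ ∘-congˡ (⟨⟩-cong (∘fst-⟨⟩ _ _ _) (∘snd-⟨⟩ _ _ _)) ⟩
    D g ∘ ⟨ h ∘ p , h ∘ q ⟩                     ∎

  linear-∘ : ∀ {g : Hom Y Z} {h : Hom X Y} → Linear g → Linear h → Linear (g ∘ h)
  linear-∘ {g = g} {h} lin-g lin-h = begin
    D (g ∘ h)                   ≈⟨ D-∘ g h ⟩
    D g ∘ ⟨ h ∘ fst , D h ⟩     ≈⟨ ∘-congʳ lin-g ⟩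
    (g ∘ snd) ∘ ⟨ h ∘ fst , D h ⟩ ≈⟨ ∘snd-⟨⟩ _ _ _ ⟩
    g ∘ D h                     ≈⟨ ∘-congˡ lin-h ⟩
    g ∘ h ∘ snd                 ≈⟨ assoc _ _ _ ⟨
    (g ∘ h) ∘ snd               ∎

  D-⟨⟩ : ∀ (f : Hom Z X) (g : Hom Z Y) → D ⟨ f , g ⟩ ≈ ⟨ D f , D g ⟩
  D-⟨⟩ f g = sym (⟨,⟩-unique (component D-fst (fst-⟨,⟩ f g)) (component D-snd (snd-⟨,⟩ f g)))
    where
    component : ∀ {p : Hom X Y} {h : Hom Z X} {k : Hom Z Y} → Linear p → p ∘ h ≈ k → p ∘ D h ≈ D k
    component {p = p} {h} {k} lin eq = begin
      p ∘ D h                         ≈⟨ ∘snd-⟨⟩ _ _ _ ⟨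
      (p ∘ snd) ∘ ⟨ h ∘ fst , D h ⟩   ≈⟨ ∘-congʳ lin ⟨
      D p ∘ ⟨ h ∘ fst , D h ⟩         ≈⟨ D-∘ p h ⟨
      D (p ∘ h)                       ≈⟨ D-cong eq ⟩
      D k                             ∎

  linear-⟨⟩ : ∀ {f : Hom Z X} {g : Hom Z Y} → Linear f → Linear g → Linear ⟨ f , g ⟩
  linear-⟨⟩ lin-f lin-g = trans (D-⟨⟩ _ _) (trans (⟨⟩-cong lin-f lin-g) (sym (⟨⟩-∘ _ _ _)))

  linear-apply : ∀ {h : Hom X Y} → Linear h → ∀ (u : Hom Z X) → h ∘ u ≈ D h ∘ ⟨ 0ₕ , u ⟩
  linear-apply lin u = trans (sym (∘snd-⟨⟩ _ _ _)) (∘-congʳ (sym lin))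

  linear-∘-0 : ∀ {h : Hom X Y} → Linear h → h ∘ 0ₕ {Z} ≈ 0ₕ
  linear-∘-0 {h = h} lin = trans (linear-apply lin 0ₕ) (Additive.0ᴹ-homo (D-additive₂ h 0ₕ))

  linear-∘-* : ∀ {h : Hom X Y} → Linear h → ∀ c (u : Hom Z X) → h ∘ (c *ₗ u) ≈ c *ₗ (h ∘ u)
  linear-∘-* {h = h} lin c u = begin
    h ∘ (c *ₗ u)              ≈⟨ linear-apply lin (c *ₗ u) ⟩
    D h ∘ ⟨ 0ₕ , c *ₗ u ⟩     ≈⟨ Additive.*ₗ-homo (D-additive₂ h 0ₕ) c u ⟩
    c *ₗ (D h ∘ ⟨ 0ₕ , u ⟩)   ≈⟨ *-congˡ (linear-apply lin u) ⟨
    c *ₗ (h ∘ u)              ∎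

  -- The axiom is the case `y = 0`. Symmetry moves `y` into the second argument, where additivity
  -- splits it off; moved back, its share is a derivative in direction 0.
  D-linear′ : ∀ (f : Hom X Y) (x y w : Hom Z X) →
              D (D f) ∘ ⟨ ⟨ x , y ⟩ , ⟨ 0ₕ , w ⟩ ⟩ ≈ D f ∘ ⟨ x , w ⟩
  D-linear′ f x y w = begin
    D (D f) ∘ ⟨ ⟨ x , y ⟩ , ⟨ 0ₕ , w ⟩ ⟩
      ≈⟨ D-symmetric f x y 0ₕ w ⟩
    D (D f) ∘ ⟨ ⟨ x , 0ₕ ⟩ , ⟨ y , w ⟩ ⟩
      ≈⟨ ∘-congˡ (⟨⟩-cong refl (trans (⟨⟩-+ y 0ₕ 0ₕ w) (⟨⟩-cong (Homs.+ᴹ-identityʳ y) (Homs.+ᴹ-identityˡ w)))) ⟨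
    D (D f) ∘ ⟨ ⟨ x , 0ₕ ⟩ , ⟨ y , 0ₕ ⟩ + ⟨ 0ₕ , w ⟩ ⟩
      ≈⟨ Additive.+ᴹ-homo (D-additive₂ (D f) ⟨ x , 0ₕ ⟩) _ _ ⟩
    D (D f) ∘ ⟨ ⟨ x , 0ₕ ⟩ , ⟨ y , 0ₕ ⟩ ⟩ + D (D f) ∘ ⟨ ⟨ x , 0ₕ ⟩ , ⟨ 0ₕ , w ⟩ ⟩
      ≈⟨ +-cong vanish (D-linear f x w) ⟩
    0ₕ + D f ∘ ⟨ x , w ⟩
      ≈⟨ Homs.+ᴹ-identityˡ _ ⟩
    D f ∘ ⟨ x , w ⟩
      ∎
    where
    vanish : D (D f) ∘ ⟨ ⟨ x , 0ₕ ⟩ , ⟨ y , 0ₕ ⟩ ⟩ ≈ 0ₕ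
    vanish = begin
      D (D f) ∘ ⟨ ⟨ x , 0ₕ ⟩ , ⟨ y , 0ₕ ⟩ ⟩   ≈⟨ D-symmetric f x 0ₕ y 0ₕ ⟩
      D (D f) ∘ ⟨ ⟨ x , y ⟩ , ⟨ 0ₕ , 0ₕ ⟩ ⟩   ≈⟨ ∘-congˡ (⟨⟩-cong refl ⟨0,0⟩) ⟩
      D (D f) ∘ ⟨ ⟨ x , y ⟩ , 0ₕ ⟩            ≈⟨ Additive.0ᴹ-homo (D-additive₂ (D f) _) ⟩
      0ₕ                                      ∎

  -- Iterated partial derivatives.

  -- P k X holds a base point and k directions, the latest direction outermost.

  P : ℕ → Obj → Obj
  P zero    X = X
  P (suc k) X = P k X × X

  ι : ∀ k → Hom X (P k X)
  ι zero    = id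
  ι (suc k) = ⟨ ι k , 0ₕ ⟩

  linear-ι : ∀ k → Linear (ι {X} k)
  linear-ι zero    = linear-id
  linear-ι (suc k) = linear-⟨⟩ (linear-ι k) linear-0

  ι-suc-∘ : ∀ k (v : Hom Z X) → ι (suc k) ∘ v ≈ ⟨ ι k ∘ v , 0ₕ ⟩
  ι-suc-∘ k v = trans (⟨⟩-∘ _ _ _) (⟨⟩-cong refl (0-∘ v))

  -- The counterpart of `f ⁽ k ⁾` for the nesting of `P`: a new direction is paired on from outside
  -- and no component has to be moved. `ι k` makes it displace the base point alone.
  ∂ : Hom X Y → ∀ k → Hom (P k X) Y
  ∂ f zero    = f
  ∂ f (suc k) = D (∂ f k) ∘ ⟨ fst , ι k ∘ snd ⟩

  ⟨fst,ι∘snd⟩-∘ : ∀ k (p : Hom Z (P k X)) (v : Hom Z X) →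
                  ⟨ fst , ι k ∘ snd ⟩ ∘ ⟨ p , v ⟩ ≈ ⟨ p , ι k ∘ v ⟩
  ⟨fst,ι∘snd⟩-∘ k p v = trans (⟨⟩-∘ _ _ _) (⟨⟩-cong (fst-⟨,⟩ _ _) (∘snd-⟨⟩ _ _ _))

  ∂-suc : ∀ (f : Hom X Y) k (p : Hom Z (P k X)) (v : Hom Z X) →
          ∂ f (suc k) ∘ ⟨ p , v ⟩ ≈ D (∂ f k) ∘ ⟨ p , ι k ∘ v ⟩
  ∂-suc f k p v = trans (assoc _ _ _) (∘-congˡ (⟨fst,ι∘snd⟩-∘ k p v))

  D∂-suc : ∀ (f : Hom X Y) k (p q : Hom Z (P k X)) (u w : Hom Z X) →
           D (∂ f (suc k)) ∘ ⟨ ⟨ p , u ⟩ , ⟨ q , w ⟩ ⟩ ≈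
           D (D (∂ f k)) ∘ ⟨ ⟨ p , ι k ∘ u ⟩ , ⟨ q , ι k ∘ w ⟩ ⟩
  D∂-suc f k p q u w = trans
    (D-∘-linear _ (linear-⟨⟩ D-fst (linear-∘ (linear-ι k) D-snd)) _ _)
    (∘-congˡ (⟨⟩-cong (⟨fst,ι∘snd⟩-∘ k p u) (⟨fst,ι∘snd⟩-∘ k q w)))

  ∂-suc-* : ∀ (f : Hom X Y) k (p : Hom Z (P k X)) c (v : Hom Z X) →
            ∂ f (suc k) ∘ ⟨ p , c *ₗ v ⟩ ≈ c *ₗ (∂ f (suc k) ∘ ⟨ p , v ⟩)
  ∂-suc-* f k p c v = begin
    ∂ f (suc k) ∘ ⟨ p , c *ₗ v ⟩             ≈⟨ ∂-suc f k p _ ⟩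
    D (∂ f k) ∘ ⟨ p , ι k ∘ (c *ₗ v) ⟩       ≈⟨ ∘-congˡ (⟨⟩-cong refl (linear-∘-* (linear-ι k) c v)) ⟩
    D (∂ f k) ∘ ⟨ p , c *ₗ (ι k ∘ v) ⟩       ≈⟨ Additive.*ₗ-homo (D-additive₂ (∂ f k) p) c _ ⟩
    c *ₗ (D (∂ f k) ∘ ⟨ p , ι k ∘ v ⟩)       ≈⟨ *-congˡ (∂-suc f k p v) ⟨
    c *ₗ (∂ f (suc k) ∘ ⟨ p , v ⟩)           ∎

  -- Both directions displace only the base point of `p`, so either side is a second derivative of
  -- `∂ f k` to which `D-symmetric` applies.
  ∂-swap : ∀ (f : Hom X Y) k (p : Hom Z (P k X)) (u v : Hom Z X) →
           ∂ f (suc (suc k)) ∘ ⟨ ⟨ p , u ⟩ , v ⟩ ≈ ∂ f (suc (suc k)) ∘ ⟨ ⟨ p , v ⟩ , u ⟩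
  ∂-swap f k p u v = begin
    ∂ f (suc (suc k)) ∘ ⟨ ⟨ p , u ⟩ , v ⟩                          ≈⟨ expand u v ⟩
    D (D (∂ f k)) ∘ ⟨ ⟨ p , ι k ∘ u ⟩ , ⟨ ι k ∘ v , ι k ∘ 0ₕ ⟩ ⟩   ≈⟨ D-symmetric _ _ _ _ _ ⟩
    D (D (∂ f k)) ∘ ⟨ ⟨ p , ι k ∘ v ⟩ , ⟨ ι k ∘ u , ι k ∘ 0ₕ ⟩ ⟩   ≈⟨ expand v u ⟨
    ∂ f (suc (suc k)) ∘ ⟨ ⟨ p , v ⟩ , u ⟩                          ∎
    where
    expand : ∀ u v → ∂ f (suc (suc k)) ∘ ⟨ ⟨ p , u ⟩ , v ⟩ ≈
                     D (D (∂ f k)) ∘ ⟨ ⟨ p , ι k ∘ u ⟩ , ⟨ ι k ∘ v , ι k ∘ 0ₕ ⟩ ⟩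
    expand u v = trans (∂-suc f (suc k) _ v)
      (trans (∘-congˡ (⟨⟩-cong refl (ι-suc-∘ k v))) (D∂-suc f k p (ι k ∘ v) u 0ₕ))

  -- Multilinearity in the directions.

  directions : ∀ k → Hom (P k X) (P k X)
  directions zero    = 0ₕ
  directions (suc k) = ⟨ directions k ∘ fst , snd ⟩

  linear-directions : ∀ k → Linear (directions {X} k)
  linear-directions zero    = linear-0
  linear-directions (suc k) = linear-⟨⟩ (linear-∘ (linear-directions k) D-fst) D-snd

  -- Positions count back from the latest direction, here and in `at`.
  rest : ∀ k → Fin (suc k) → Hom (P (suc k) X) (P k X)
  rest k       zero    = fst
  rest (suc k) (suc j) = ⟨ rest k j ∘ fst , snd ⟩

  at : ∀ k → Fin (suc k) → Hom (P (suc k) X) X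
  at k       zero    = snd
  at (suc k) (suc j) = at k j ∘ fst

  linear-rest : ∀ k j → Linear (rest {X} k j)
  linear-rest k       zero    = D-fst
  linear-rest (suc k) (suc j) = linear-⟨⟩ (linear-∘ (linear-rest k j) D-fst) D-snd

  linear-at : ∀ k j → Linear (at {X} k j)
  linear-at k       zero    = D-snd
  linear-at (suc k) (suc j) = linear-∘ (linear-at k j) D-fst

  rest-ι : ∀ k j → rest {X} k j ∘ ι (suc k) ≈ ι k
  rest-ι k       zero    = fst-⟨,⟩ _ _
  rest-ι (suc k) (suc j) =
    trans (⟨⟩-∘ _ _ _) (⟨⟩-cong (trans (∘fst-⟨⟩ _ _ _) (rest-ι k j)) (snd-⟨,⟩ _ _))

  -- ∂ f k is linear in each direction, by induction: the derivative of the
  -- statement for ∂ f k is the statement for all but the latest direction of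
  -- ∂ f (suc k).

  directionalSum : Hom X Y → ∀ k → Hom Z (P k X) → Hom Z (P k X) → Hom Z Y
  directionalSum f zero    p q = 0ₕ
  directionalSum f (suc k) p q = sumₕ (λ j → ∂ f (suc k) ∘ ⟨ rest k j ∘ p , at k j ∘ q ⟩)

  -- The Leibniz rule of a multilinear map: `directions` freezes the base point, and each summand
  -- replaces one direction of `p` by that of `q`. Symmetry permits writing the replacement
  -- outermost.
  D∂-directions : ∀ (f : Hom X Y) k (p q : Hom Z (P k X)) →
                  D (∂ f k) ∘ ⟨ p , directions k ∘ q ⟩ ≈ directionalSum f k p q

  -- The derivative of the preceding identity when only the base point of `p` moves. It is
  -- differentiated at `fst` and `snd`; the linear map `h` brings the left side into that form.
  DD∂-directions : ∀ (f : Hom X Y) k (p q : Hom Z (P k X)) (u : Hom Z X) →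
                   D (D (∂ f k)) ∘ ⟨ ⟨ p , directions k ∘ q ⟩ , ⟨ ι k ∘ u , 0ₕ ⟩ ⟩ ≈
                   D (directionalSum f k fst snd) ∘ ⟨ ⟨ p , q ⟩ , ⟨ ι k ∘ u , 0ₕ ⟩ ⟩
  DD∂-directions {X = X} f k p q u = begin
    D (D (∂ f k)) ∘ ⟨ ⟨ p , directions k ∘ q ⟩ , ⟨ ι k ∘ u , 0ₕ ⟩ ⟩
      ≈⟨ ∘-congˡ (⟨⟩-cong (h-∘ p q)
           (trans (h-∘ (ι k ∘ u) 0ₕ) (⟨⟩-cong refl (linear-∘-0 (linear-directions k))))) ⟨
    D (D (∂ f k)) ∘ ⟨ h ∘ ⟨ p , q ⟩ , h ∘ ⟨ ι k ∘ u , 0ₕ ⟩ ⟩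
      ≈⟨ D-∘-linear _ linear-h _ _ ⟨
    D (D (∂ f k) ∘ h) ∘ ⟨ ⟨ p , q ⟩ , ⟨ ι k ∘ u , 0ₕ ⟩ ⟩
      ≈⟨ ∘-congʳ (D-cong (D∂-directions f k fst snd)) ⟩
    D (directionalSum f k fst snd) ∘ ⟨ ⟨ p , q ⟩ , ⟨ ι k ∘ u , 0ₕ ⟩ ⟩
      ∎
    where
    h : Hom (S (P k X)) (S (P k X))
    h = ⟨ fst , directions k ∘ snd ⟩

    linear-h : Linear h
    linear-h = linear-⟨⟩ D-fst (linear-∘ (linear-directions k) D-snd)

    h-∘ : ∀ {W} (p q : Hom W (P k X)) → h ∘ ⟨ p , q ⟩ ≈ ⟨ p , directions k ∘ q ⟩
    h-∘ p q = trans (⟨⟩-∘ _ _ _) (⟨⟩-cong (fst-⟨,⟩ _ _) (∘snd-⟨⟩ _ _ _))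

  -- Each summand is `∂ f (suc k)` after a linear map, so moving the base point adjoins `u` as
  -- outermost direction; `∂-swap` puts it behind the replacement.
  D-directionalSum : ∀ (f : Hom X Y) k (p q : Hom Z (P (suc k) X)) (u : Hom Z X) →
                     D (directionalSum f (suc k) fst snd) ∘ ⟨ ⟨ p , q ⟩ , ⟨ ι (suc k) ∘ u , 0ₕ ⟩ ⟩ ≈
                     sumₕ (λ j → ∂ f (suc (suc k)) ∘ ⟨ ⟨ rest k j ∘ p , u ⟩ , at k j ∘ q ⟩)
  D-directionalSum f k p q u = begin
    D (sumₕ F) ∘ e
      ≈⟨ ∘-congʳ (sum-homo (Additive.+ᴹ-homo D-additive) (Additive.0ᴹ-homo D-additive) F) ⟩
    sumₕ (D ⊙ F) ∘ e
      ≈⟨ sum-homo (λ g g′ → +-∘ g g′ e) (0-∘ e) (D ⊙ F) ⟩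
    sumₕ (λ j → D (F j) ∘ e)
      ≈⟨ sum-cong term ⟩
    sumₕ (λ j → ∂ f (suc (suc k)) ∘ ⟨ ⟨ rest k j ∘ p , u ⟩ , at k j ∘ q ⟩)
      ∎
    where
    e = ⟨ ⟨ p , q ⟩ , ⟨ ι (suc k) ∘ u , 0ₕ ⟩ ⟩
    h = λ j → ⟨ rest k j ∘ fst , at k j ∘ snd ⟩
    F = λ j → ∂ f (suc k) ∘ h j

    h-∘ : ∀ j {W} (p q : Hom W (P (suc k) _)) → h j ∘ ⟨ p , q ⟩ ≈ ⟨ rest k j ∘ p , at k j ∘ q ⟩
    h-∘ j p q = trans (⟨⟩-∘ _ _ _) (⟨⟩-cong (∘fst-⟨⟩ _ _ _) (∘snd-⟨⟩ _ _ _))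

    term : ∀ j → D (F j) ∘ e ≈ ∂ f (suc (suc k)) ∘ ⟨ ⟨ rest k j ∘ p , u ⟩ , at k j ∘ q ⟩
    term j = begin
      D (F j) ∘ e
        ≈⟨ D-∘-linear _ (linear-⟨⟩ (linear-∘ (linear-rest k j) D-fst) (linear-∘ (linear-at k j) D-snd)) _ _ ⟩
      D (∂ f (suc k)) ∘ ⟨ h j ∘ ⟨ p , q ⟩ , h j ∘ ⟨ ι (suc k) ∘ u , 0ₕ ⟩ ⟩
        ≈⟨ ∘-congˡ (⟨⟩-cong (h-∘ j p q) (trans (h-∘ j _ _)
             (⟨⟩-cong (trans (sym (assoc _ _ _)) (∘-congʳ (rest-ι k j))) (linear-∘-0 (linear-at k j))))) ⟩
      D (∂ f (suc k)) ∘ ⟨ ⟨ rest k j ∘ p , at k j ∘ q ⟩ , ⟨ ι k ∘ u , 0ₕ ⟩ ⟩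
        ≈⟨ trans (∂-suc f (suc k) _ u) (∘-congˡ (⟨⟩-cong refl (ι-suc-∘ k u))) ⟨
      ∂ f (suc (suc k)) ∘ ⟨ ⟨ rest k j ∘ p , at k j ∘ q ⟩ , u ⟩
        ≈⟨ ∂-swap f k _ _ _ ⟩
      ∂ f (suc (suc k)) ∘ ⟨ ⟨ rest k j ∘ p , u ⟩ , at k j ∘ q ⟩
        ∎

  D∂-directions f zero    p q = trans (∘-congˡ (⟨⟩-cong refl (0-∘ q))) (Additive.0ᴹ-homo (D-additive₂ f p))
  D∂-directions {X = X} {Z = Z} f (suc k) p q = begin
    D (∂ f (suc k)) ∘ ⟨ p , directions (suc k) ∘ q ⟩
      ≈⟨ ∘-congˡ (⟨⟩-cong (sym (⟨⟩-η p)) (trans (⟨⟩-∘ _ _ _) (⟨⟩-cong (assoc _ _ _) refl))) ⟩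
    D (∂ f (suc k)) ∘ ⟨ ⟨ p₀ , u ⟩ , ⟨ directions k ∘ q₀ , w ⟩ ⟩
      ≈⟨ D∂-suc f k _ _ _ _ ⟩
    D (D (∂ f k)) ∘ ⟨ ⟨ p₀ , ι k ∘ u ⟩ , ⟨ directions k ∘ q₀ , ι k ∘ w ⟩ ⟩
      ≈⟨ ∘-congˡ (⟨⟩-cong refl (trans (⟨⟩-+ _ _ _ _)
           (⟨⟩-cong (Homs.+ᴹ-identityˡ _) (Homs.+ᴹ-identityʳ _)))) ⟨
    D (D (∂ f k)) ∘ ⟨ ⟨ p₀ , ι k ∘ u ⟩ , ⟨ 0ₕ , ι k ∘ w ⟩ + ⟨ directions k ∘ q₀ , 0ₕ ⟩ ⟩
      ≈⟨ Additive.+ᴹ-homo (D-additive₂ (D (∂ f k)) _) _ _ ⟩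
    D (D (∂ f k)) ∘ ⟨ ⟨ p₀ , ι k ∘ u ⟩ , ⟨ 0ₕ , ι k ∘ w ⟩ ⟩ +
    D (D (∂ f k)) ∘ ⟨ ⟨ p₀ , ι k ∘ u ⟩ , ⟨ directions k ∘ q₀ , 0ₕ ⟩ ⟩
      -- The first summand varies only the latest direction, in which a derivative is linear: it is
      -- the term for position 0. In the second, symmetry exchanges the variation of the earlier
      -- directions with `ι k ∘ u`, which exposes the derivative of the induction hypothesis along
      -- `u`.
      ≈⟨ +-cong (trans (D-linear′ _ _ _ _) (sym (∂-suc f k p₀ w)))
                (trans (D-symmetric _ _ _ _ _) (DD∂-directions f k p₀ q₀ u)) ⟩
    ∂ f (suc k) ∘ ⟨ p₀ , w ⟩ + D (directionalSum f k fst snd) ∘ ⟨ ⟨ p₀ , q₀ ⟩ , ⟨ ι k ∘ u , 0ₕ ⟩ ⟩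
      ≈⟨ +-congˡ (earlier k p q) ⟩
    directionalSum f (suc k) p q
      ∎
    where
    p₀ q₀ : Hom Z (P k X)
    p₀ = fst ∘ p
    q₀ = fst ∘ q

    u w : Hom Z X
    u = snd ∘ p
    w = snd ∘ q

    earlier : ∀ k (p q : Hom Z (P (suc k) X)) →
              D (directionalSum f k fst snd) ∘ ⟨ ⟨ fst ∘ p , fst ∘ q ⟩ , ⟨ ι k ∘ snd ∘ p , 0ₕ ⟩ ⟩ ≈
              sumₕ (λ j → ∂ f (suc k) ∘ ⟨ rest k (suc j) ∘ p , at k (suc j) ∘ q ⟩)
    earlier zero    p q = trans (∘-congʳ (Additive.0ᴹ-homo D-additive)) (0-∘ _)
    earlier (suc k) p q = trans (D-directionalSum f k (fst ∘ p) (fst ∘ q) (snd ∘ p)) (sum-cong term)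
      where
      term : ∀ j → ∂ f (suc (suc k)) ∘ ⟨ ⟨ rest k j ∘ fst ∘ p , snd ∘ p ⟩ , at k j ∘ fst ∘ q ⟩ ≈
                   ∂ f (suc (suc k)) ∘ ⟨ rest (suc k) (suc j) ∘ p , at (suc k) (suc j) ∘ q ⟩
      term j = ∘-congˡ (⟨⟩-cong (sym (trans (⟨⟩-∘ _ _ _) (⟨⟩-cong (assoc _ _ _) refl))) (sym (assoc _ _ _)))

  -- Higher derivatives in directions listed by indices.

  point : Hom Z X → (ℕ → Hom Z X) → ∀ is → Hom Z (P (length is) X)
  point x u []       = x
  point x u (i ∷ is) = ⟨ point x u is , u i ⟩

  multi∂ : Hom X Y → Hom Z X → (ℕ → Hom Z X) → List ℕ → Hom Z Y
  multi∂ f x u is = ∂ f (length is) ∘ point x u is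

  point-cong : ∀ {x x′ : Hom Z X} {u u′ : ℕ → Hom Z X} → x ≈ x′ →
               ∀ {is} → ListAll.All (λ i → u i ≈ u′ i) is → point x u is ≈ point x′ u′ is
  point-cong x≈x′ []         = x≈x′
  point-cong x≈x′ (eq ∷ eqs) = ⟨⟩-cong (point-cong x≈x′ eqs) eq

  point-∘ : ∀ (x : Hom Z X) u is (h : Hom W Z) → point x u is ∘ h ≈ point (x ∘ h) (λ i → u i ∘ h) is
  point-∘ x u []       h = refl
  point-∘ x u (i ∷ is) h = trans (⟨⟩-∘ _ _ _) (⟨⟩-cong (point-∘ x u is h) refl)

  linear-point : ∀ {x : Hom Z X} {u} → Linear x → (∀ i → Linear (u i)) → ∀ is → Linear (point x u is)
  linear-point lin-x lin-u []       = lin-x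
  linear-point lin-x lin-u (i ∷ is) = linear-⟨⟩ (linear-point lin-x lin-u is) (lin-u i)

  point-split : ∀ (x : Hom Z X) u is →
                point x u is ≈ ι (length is) ∘ x + directions (length is) ∘ point x u is
  point-split x u []       =
    sym (trans (+-cong (identityˡ x) (0-∘ x)) (Homs.+ᴹ-identityʳ x))
  point-split x u (i ∷ is) = sym (begin
    ι (suc (length is)) ∘ x + directions (suc (length is)) ∘ ⟨ point x u is , u i ⟩
      ≈⟨ +-cong (ι-suc-∘ (length is) x)
           (trans (⟨⟩-∘ _ _ _) (⟨⟩-cong (∘fst-⟨⟩ _ _ _) (snd-⟨,⟩ _ _))) ⟩
    ⟨ ι (length is) ∘ x , 0ₕ ⟩ + ⟨ directions (length is) ∘ point x u is , u i ⟩
      ≈⟨ ⟨⟩-+ _ _ _ _ ⟩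
    ⟨ ι (length is) ∘ x + directions (length is) ∘ point x u is , 0ₕ + u i ⟩
      ≈⟨ ⟨⟩-cong (point-split x u is) (sym (Homs.+ᴹ-identityˡ (u i))) ⟨
    ⟨ point x u is , u i ⟩
      ∎)

  private open module PickSum {X Y} = CompositionSums (hom X Y) using (pickSum)

  -- Generalised over `F` so that the induction can absorb each direction `u i` that it passes into
  -- the first argument of `F`.
  sum-pick : ∀ (F : ∀ k → Hom Z (P k X) → Hom Z X → Hom W Y) →
             (∀ k {p p′ v v′} → p ≈ p′ → v ≈ v′ → F k p v ≈ F k p′ v′) →
             ∀ x u v w i is →
             sumₕ (λ j → F (length is) (rest (length is) j ∘ point x u (i ∷ is))
                                      (at (length is) j ∘ point v w (i ∷ is))) ≈
             pickSum (λ h t → F (length t) (point x u t) (w h)) (i ∷ is)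
  sum-pick F F-cong x u v w i []        = +-congʳ (F-cong 0 (fst-⟨,⟩ _ _) (snd-⟨,⟩ _ _))
  sum-pick F F-cong x u v w i (i′ ∷ is) = +-cong
    (F-cong _ (fst-⟨,⟩ _ _) (snd-⟨,⟩ _ _))
    (trans
      (sum-cong term)
      (sum-pick (λ k p v → F (suc k) ⟨ p , u i ⟩ v)
                (λ k p≈p′ v≈v′ → F-cong (suc k) (⟨⟩-cong p≈p′ refl) v≈v′) x u v w i′ is))
    where
    k = length is

    term : ∀ j → F (suc k) (rest (suc k) (suc j) ∘ point x u (i ∷ i′ ∷ is))
                           (at (suc k) (suc j) ∘ point v w (i ∷ i′ ∷ is)) ≈
                 F (suc k) ⟨ rest k j ∘ point x u (i′ ∷ is) , u i ⟩ (at k j ∘ point v w (i′ ∷ is))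
    term j = F-cong (suc k)
      (trans (⟨⟩-∘ _ _ _) (⟨⟩-cong (∘fst-⟨⟩ _ _ _) (snd-⟨,⟩ _ _)))
      (∘fst-⟨⟩ _ _ _)

  -- Moving the base point adjoins the direction `v`, moving a direction replaces it. Along `ν`
  -- these become the adjoined part 1 and the incremented parts.
  D∂-point : ∀ (f : Hom X Y) (x : Hom Z X) u v w is →
             D (∂ f (length is)) ∘ ⟨ point x u is , point v w is ⟩ ≈
             ∂ f (suc (length is)) ∘ ⟨ point x u is , v ⟩ +
             pickSum (λ h t → ∂ f (suc (length t)) ∘ ⟨ point x u t , w h ⟩) is
  D∂-point f x u v w is = begin
    D (∂ f k) ∘ ⟨ p , q ⟩
      ≈⟨ ∘-congˡ (⟨⟩-cong refl (point-split v w is)) ⟩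
    D (∂ f k) ∘ ⟨ p , ι k ∘ v + directions k ∘ q ⟩
      ≈⟨ Additive.+ᴹ-homo (D-additive₂ (∂ f k) p) _ _ ⟩
    D (∂ f k) ∘ ⟨ p , ι k ∘ v ⟩ + D (∂ f k) ∘ ⟨ p , directions k ∘ q ⟩
      ≈⟨ +-cong (sym (∂-suc f k p v)) (trans (D∂-directions f k p q) (directional is)) ⟩
    ∂ f (suc k) ∘ ⟨ p , v ⟩ + pickSum (λ h t → ∂ f (suc (length t)) ∘ ⟨ point x u t , w h ⟩) is
      ∎
    where
    k = length is
    p = point x u is
    q = point v w is

    directional : ∀ is → directionalSum f (length is) (point x u is) (point v w is) ≈
                  pickSum (λ h t → ∂ f (suc (length t)) ∘ ⟨ point x u t , w h ⟩) is
    directional []       = refl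
    directional (i ∷ is) = sum-pick (λ k p v → ∂ f (suc k) ∘ ⟨ p , v ⟩)
      (λ k p≈p′ v≈v′ → ∘-congˡ (⟨⟩-cong p≈p′ v≈v′)) x u v w i is

  -- Symmetry under permutations of the directions.

  -- A rearrangement of the directions acts on P by a linear map; linearity
  -- is what carries the invariance of ∂ f k over to ∂ f (suc k).

  record Rearrangement (f : Hom X Y) (k l : ℕ) : Set (m ⊔ ℓm) where
    field
      map       : Hom (P k X) (P l X)
      linear    : Linear map
      map-ι     : map ∘ ι k ≈ ι l
      invariant : ∂ f l ∘ map ≈ ∂ f k

  open Rearrangement

  idᴿ : ∀ (f : Hom X Y) k → Rearrangement f k k
  idᴿ f k = record
    { map       = id
    ; linear    = linear-id
    ; map-ι     = identityˡ _
    ; invariant = identityʳ _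
    }

  _∘ᴿ_ : ∀ {f : Hom X Y} {j k l} → Rearrangement f k l → Rearrangement f j k → Rearrangement f j l
  σ ∘ᴿ τ = record
    { map       = map σ ∘ map τ
    ; linear    = linear-∘ (linear σ) (linear τ)
    ; map-ι     = trans (assoc _ _ _) (trans (∘-congˡ (map-ι τ)) (map-ι σ))
    ; invariant = trans (sym (assoc _ _ _)) (trans (∘-congʳ (invariant σ)) (invariant τ))
    }

  prepᴿ : ∀ {f : Hom X Y} {k l} → Rearrangement f k l → Rearrangement f (suc k) (suc l)
  prepᴿ {f = f} {k} {l} τ = record
    { map       = ⟨ map τ ∘ fst , snd ⟩
    ; linear    = linear-⟨⟩ (linear-∘ (linear τ) D-fst) D-snd
    ; map-ι     = trans (⟨⟩-∘ _ _ _) (⟨⟩-cong (trans (∘fst-⟨⟩ _ _ _) (map-ι τ)) (snd-⟨,⟩ _ _))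
    ; invariant = begin
        ∂ f (suc l) ∘ ⟨ map τ ∘ fst , snd ⟩
          ≈⟨ ∂-suc f l _ _ ⟩
        D (∂ f l) ∘ ⟨ map τ ∘ fst , ι l ∘ snd ⟩
          -- The new direction displaces the base point, which `τ` leaves in place; hence `ι l`
          -- factors through `map τ` and the chain rule can be read backwards.
          ≈⟨ ∘-congˡ (⟨⟩-cong refl (trans (∘-congʳ (sym (map-ι τ))) (assoc _ _ _))) ⟩
        D (∂ f l) ∘ ⟨ map τ ∘ fst , map τ ∘ ι k ∘ snd ⟩
          ≈⟨ D-∘-linear (∂ f l) (linear τ) _ _ ⟨
        D (∂ f l ∘ map τ) ∘ ⟨ fst , ι k ∘ snd ⟩
          ≈⟨ ∘-congʳ (D-cong (invariant τ)) ⟩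
        ∂ f (suc k)
          ∎
    }

  prepᴿ-∘ : ∀ {f : Hom X Y} {k l} (τ : Rearrangement f k l) {p : Hom Z (P k X)} {p′} {v : Hom Z X} →
            map τ ∘ p ≈ p′ → map (prepᴿ τ) ∘ ⟨ p , v ⟩ ≈ ⟨ p′ , v ⟩
  prepᴿ-∘ τ eq = trans (⟨⟩-∘ _ _ _) (⟨⟩-cong (trans (∘fst-⟨⟩ _ _ _) eq) (snd-⟨,⟩ _ _))

  swap-∘ : ∀ (p : Hom Z W) (u : Hom Z X) (v : Hom Z Y) →
           ⟨ ⟨ fst ∘ fst , snd ⟩ , snd ∘ fst ⟩ ∘ ⟨ ⟨ p , u ⟩ , v ⟩ ≈ ⟨ ⟨ p , v ⟩ , u ⟩
  swap-∘ p u v = trans (⟨⟩-∘ _ _ _) (⟨⟩-cong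
    (trans (⟨⟩-∘ _ _ _) (⟨⟩-cong (trans (∘fst-⟨⟩ _ _ _) (fst-⟨,⟩ _ _)) (snd-⟨,⟩ _ _)))
    (trans (∘fst-⟨⟩ _ _ _) (snd-⟨,⟩ _ _)))

  swapᴿ : ∀ (f : Hom X Y) k → Rearrangement f (suc (suc k)) (suc (suc k))
  swapᴿ f k = record
    { map       = ⟨ ⟨ fst ∘ fst , snd ⟩ , snd ∘ fst ⟩
    ; linear    = linear-⟨⟩ (linear-⟨⟩ (linear-∘ D-fst D-fst) D-snd) (linear-∘ D-snd D-fst)
    ; map-ι     = swap-∘ (ι k) 0ₕ 0ₕ
    ; invariant = begin
        ∂ f (suc (suc k)) ∘ ⟨ ⟨ fst ∘ fst , snd ⟩ , snd ∘ fst ⟩   ≈⟨ ∂-swap f k _ _ _ ⟩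
        ∂ f (suc (suc k)) ∘ ⟨ ⟨ fst ∘ fst , snd ∘ fst ⟩ , snd ⟩
          ≈⟨ ∘-congˡ (trans (⟨⟩-cong (⟨⟩-η fst) refl) (⟨,⟩-unique (identityʳ fst) (identityʳ snd))) ⟩
        ∂ f (suc (suc k)) ∘ id                                    ≈⟨ identityʳ _ ⟩
        ∂ f (suc (suc k))                                         ∎
    }

  rearrange : ∀ (f : Hom X Y) (x : Hom Z X) u {is js} → is ↭ js →
              ∃ λ (τ : Rearrangement f (length is) (length js)) → map τ ∘ point x u is ≈ point x u js
  rearrange f x u {is} Perm.refl         = idᴿ f (length is) , identityˡ _
  rearrange f x u (Perm.prep i is↭js) with rearrange f x u is↭js
  ... | τ , eq = prepᴿ τ , prepᴿ-∘ τ eq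
  rearrange f x u {js = _ ∷ _ ∷ js} (Perm.swap i j is↭js) with rearrange f x u is↭js
  ... | τ , eq = swapᴿ f (length js) ∘ᴿ prepᴿ (prepᴿ τ) , trans (assoc _ _ _)
    (trans (∘-congˡ (prepᴿ-∘ (prepᴿ τ) (prepᴿ-∘ τ eq))) (swap-∘ _ _ _))
  rearrange f x u (Perm.trans is↭js js↭ks) with rearrange f x u is↭js | rearrange f x u js↭ks
  ... | τ , eq | σ , eq′ = σ ∘ᴿ τ , trans (assoc _ _ _) (trans (∘-congˡ eq) eq′)

  multi∂-↭ : ∀ (f : Hom X Y) (x : Hom Z X) u {is js} → is ↭ js → multi∂ f x u is ≈ multi∂ f x u js
  multi∂-↭ f x u is↭js with rearrange f x u is↭js
  ... | τ , eq = trans (∘-congʳ (sym (invariant τ))) (trans (assoc _ _ _) (∘-congˡ eq))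

parts-≤ : ∀ is {n} → sum is ≤ n → ListAll.All (_≤ n) is
parts-≤ []       _      = []
parts-≤ (i ∷ is) i+is≤n = ℕ.m+n≤o⇒m≤o i i+is≤n ∷ parts-≤ is (ℕ.m+n≤o⇒n≤o i i+is≤n)

-- In `point` the head of the list is the outermost, latest direction, while `f ⁽ k ⁾` has its
-- latest direction last in the tuple. Translation thus reverses the parts; the index 0 of `js` is
-- the base point and is left out.
latestFirst : ∀ k → Vector ℕ (suc k) → List ℕ
latestFirst zero    js = []
latestFirst (suc k) js = js (fromℕ (suc k)) ∷ latestFirst k (js ⊙ inject₁)

latestFirst-↭ : ∀ k js → latestFirst k js ↭ List.tabulate (js ⊙ suc)
latestFirst-↭ zero    js = Perm.refl
latestFirst-↭ (suc k) js = Perm.trans (prep _ (latestFirst-↭ k (js ⊙ inject₁))) (last-first k (js ⊙ suc))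
  where
  last-first : ∀ k (js : Vector ℕ (suc k)) →
               js (fromℕ k) ∷ List.tabulate (js ⊙ inject₁) ↭ List.tabulate js
  last-first zero    js = Perm.refl
  last-first (suc k) js = Perm.trans (swap _ _ Perm.refl) (prep _ (last-first k (js ⊙ suc)))

tabulate-lookup-toℕ : ∀ {N k} (is : Vec (Fin N) k) →
                      List.tabulate (λ j → toℕ (lookup is j)) ≡ parts is
tabulate-lookup-toℕ []       = ≡.refl
tabulate-lookup-toℕ (i ∷ is) = ≡.cong (toℕ i ∷_) (tabulate-lookup-toℕ is)

-- Taylor terms and their recursion.

module TaylorExpansion {r ℓr o m ℓm} {R : CommutativeSemiring r ℓr} (inv : HasIntegerInverses R)
                       (C : CartesianDifferentialCategory R o m ℓm) where
  open CartesianDifferentialCategory C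
  open Taylor inv C
  open DifferentialCalculus C
  open Homs using ()
    renaming (≈ᴹ-refl to refl; ≈ᴹ-sym to sym; ≈ᴹ-trans to trans; ≈ᴹ-reflexive to reflexive; +ᴹ-cong to +-cong;
              +ᴹ-congˡ to +-congˡ; +ᴹ-congʳ to +-congʳ; *ₗ-congˡ to *-congˡ)
  open ≈-Reasoning
  open module ExpSum {X Y} = ExponentialSums inv (hom X Y) using (expTerm; expSum; expSum-cong; expSum-suc; expSum-suc-foldSum) public
  open module CompSum {X Y} = CompositionSums (hom X Y)
  open module CompIds {X Y} = CompositionIdentities (hom X Y) using (module Scaling; incrementSum; fromNat-1-*ₗ)
  open module CompEnum {X Y} = CompositionEnumeration (hom X Y)
    using (foldSum-cong; foldSum-compositions)

  private
    variable
      X Y Z : Obj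

  ⟪⟫-cong : ∀ {n} {fs gs : Vector (Hom Z X) (suc n)} → (∀ i → fs i ≈ gs i) → ⟪ fs ⟫ ≈ ⟪ gs ⟫
  ⟪⟫-cong {n = zero}  eq = eq zero
  ⟪⟫-cong {n = suc n} eq = ⟨⟩-cong (eq zero) (⟪⟫-cong (eq ⊙ suc))

  ⟪⟫-∘ : ∀ {W n} (fs : Vector (Hom Z X) (suc n)) (h : Hom W Z) → ⟪ fs ⟫ ∘ h ≈ ⟪ (λ i → fs i ∘ h) ⟫
  ⟪⟫-∘ {n = zero}  fs h = refl
  ⟪⟫-∘ {n = suc n} fs h = trans (⟨⟩-∘ _ _ _) (⟨⟩-cong refl (⟪⟫-∘ (fs ⊙ suc) h))

  π-⟪⟫ : ∀ n i (fs : Vector (Hom Z X) (suc n)) → π n i ∘ ⟪ fs ⟫ ≈ fs i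
  π-⟪⟫ zero    zero    fs = identityˡ _
  π-⟪⟫ (suc n) zero    fs = fst-⟨,⟩ _ _
  π-⟪⟫ (suc n) (suc i) fs = trans (∘snd-⟨⟩ _ _ _) (π-⟪⟫ n i (fs ⊙ suc))

  ⟪π⟫ : ∀ n → ⟪ π n {X} ⟫ ≈ id
  ⟪π⟫ zero    = refl
  ⟪π⟫ (suc n) = ⟨,⟩-unique (identityʳ fst) (sym (begin
    ⟪ (λ i → π n i ∘ snd) ⟫   ≈⟨ ⟪⟫-∘ (π n) snd ⟨
    ⟪ π n ⟫ ∘ snd             ≈⟨ ∘-congʳ (⟪π⟫ n) ⟩
    id ∘ snd                  ≈⟨ identityˡ snd ⟩
    snd                       ≈⟨ identityʳ snd ⟨
    snd ∘ id                  ∎))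

  linear-π : ∀ n i → Linear (π n {X} i)
  linear-π {X} n i = D-proj (λ _ → X) i

  snocPoint : ∀ k → Vector (Hom Z X) (suc k) → Hom Z (P k X)
  snocPoint zero    fs = fs zero
  snocPoint (suc k) fs = ⟨ snocPoint k (fs ⊙ inject₁) , fs (fromℕ (suc k)) ⟩

  snocPoint-cong : ∀ k {fs gs : Vector (Hom Z X) (suc k)} → (∀ i → fs i ≈ gs i) →
                   snocPoint k fs ≈ snocPoint k gs
  snocPoint-cong zero    eq = eq zero
  snocPoint-cong (suc k) eq = ⟨⟩-cong (snocPoint-cong k (eq ⊙ inject₁)) (eq (fromℕ (suc k)))

  snocPoint-∘ : ∀ {W} k (fs : Vector (Hom Z X) (suc k)) (h : Hom W Z) →
                snocPoint k fs ∘ h ≈ snocPoint k (λ i → fs i ∘ h)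
  snocPoint-∘ zero    fs h = refl
  snocPoint-∘ (suc k) fs h = trans (⟨⟩-∘ _ _ _) (⟨⟩-cong (snocPoint-∘ k (fs ⊙ inject₁) h) refl)

  linear-snocPoint : ∀ k {fs : Vector (Hom Z X) (suc k)} → (∀ i → Linear (fs i)) → Linear (snocPoint k fs)
  linear-snocPoint zero    lin = lin zero
  linear-snocPoint (suc k) lin = linear-⟨⟩ (linear-snocPoint k (lin ⊙ inject₁)) (lin (fromℕ (suc k)))

  snocPoint-ι : ∀ k (v : Hom Z X) → snocPoint k (v Vector.∷ Vector.replicate k 0ₕ) ≈ ι k ∘ v
  snocPoint-ι zero    v = sym (identityˡ v)
  snocPoint-ι (suc k) v = trans
    (⟨⟩-cong (trans (snocPoint-cong k λ { zero → refl ; (suc i) → refl }) (snocPoint-ι k v)) refl)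
    (sym (ι-suc-∘ k v))

  snocPoint-π-⟪⟫ : ∀ k (fs : Vector (Hom Z X) (suc k)) → snocPoint k (π k) ∘ ⟪ fs ⟫ ≈ snocPoint k fs
  snocPoint-π-⟪⟫ k fs = trans (snocPoint-∘ k (π k) ⟪ fs ⟫) (snocPoint-cong k (λ i → π-⟪⟫ k i fs))

  -- Regrouping `S[ k ] X` as `P k X` is linear and takes displacements of the base point to `ι k`,
  -- so it is compatible with one more partial derivative.
  ⁽⁾-∂ : ∀ (f : Hom X Y) k (fs : Vector (Hom Z X) (suc k)) → f ⁽ k ⁾ ∘ ⟪ fs ⟫ ≈ ∂ f k ∘ snocPoint k fs
  ⁽⁾-∂ f zero    fs = refl
  ⁽⁾-∂ {X} {Z = Z} f (suc k) fs = begin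
    (D (f ⁽ k ⁾) ∘ ⟨ ⟪ α ⟫ , ⟪ β ⟫ ⟩) ∘ ⟪ fs ⟫
      ≈⟨ trans (assoc _ _ _) (∘-congˡ (⟨⟩-∘ _ _ _)) ⟩
    D (f ⁽ k ⁾) ∘ ⟨ ⟪ α ⟫ ∘ ⟪ fs ⟫ , ⟪ β ⟫ ∘ ⟪ fs ⟫ ⟩
      ≈⟨ ∘-congˡ (⟨⟩-cong
           (trans (⟪⟫-∘ α ⟪ fs ⟫) (⟪⟫-cong (λ i → π-⟪⟫ (suc k) (inject₁ i) fs)))
           (trans (⟪⟫-∘ β ⟪ fs ⟫) (⟪⟫-cong β-∘))) ⟩
    D (f ⁽ k ⁾) ∘ ⟨ ⟪ fs ⊙ inject₁ ⟫ , ⟪ δ ⟫ ⟩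
      -- The induction hypothesis at the generic tuple `π k`, whose tupling is the identity, is an
      -- equation of morphisms and can be differentiated.
      ≈⟨ ∘-congʳ (D-cong (trans (sym (identityʳ _)) (trans (∘-congˡ (sym (⟪π⟫ k))) (⁽⁾-∂ f k (π k))))) ⟩
    D (∂ f k ∘ snocPoint k (π k)) ∘ ⟨ ⟪ fs ⊙ inject₁ ⟫ , ⟪ δ ⟫ ⟩
      ≈⟨ D-∘-linear (∂ f k) (linear-snocPoint k (linear-π k)) _ _ ⟩
    D (∂ f k) ∘ ⟨ snocPoint k (π k) ∘ ⟪ fs ⊙ inject₁ ⟫ , snocPoint k (π k) ∘ ⟪ δ ⟫ ⟩
      ≈⟨ ∘-congˡ (⟨⟩-cong (snocPoint-π-⟪⟫ k _) (trans (snocPoint-π-⟪⟫ k δ) (snocPoint-ι k _))) ⟩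
    D (∂ f k) ∘ ⟨ snocPoint k (fs ⊙ inject₁) , ι k ∘ fs (fromℕ (suc k)) ⟩
      ≈⟨ ∂-suc f k _ _ ⟨
    ∂ f (suc k) ∘ snocPoint (suc k) fs
      ∎
    where
    α β : Vector (Hom (S[ suc k ] X) X) (suc k)
    α i = π (suc k) (inject₁ i)
    β = π (suc k) (fromℕ (suc k)) Vector.∷ Vector.replicate k 0ₕ

    δ : Vector (Hom Z X) (suc k)
    δ = fs (fromℕ (suc k)) Vector.∷ Vector.replicate k 0ₕ

    β-∘ : ∀ i → β i ∘ ⟪ fs ⟫ ≈ δ i
    β-∘ zero    = π-⟪⟫ (suc k) (fromℕ (suc k)) fs
    β-∘ (suc i) = 0-∘ _

  -- The length of `latestFirst k js` is `k` only propositionally. Comparing pairs of a length and a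
  -- point avoids transport between the objects `P k X`.
  ∂-snocPoint : ∀ (f : Hom X Y) (u : ℕ → Hom Z X) k (js : Vector ℕ (suc k)) →
                ∂ f k ∘ snocPoint k (u ⊙ js) ≡ multi∂ f (u (js zero)) u (latestFirst k js)
  ∂-snocPoint {X} {Z = Z} f u k js = ≡.cong (λ (k , p) → ∂ f k ∘ p) (same k js)
    where
    same : ∀ k (js : Vector ℕ (suc k)) → _≡_ {A = ∃ λ k → Hom Z (P k X)}
           (k , snocPoint k (u ⊙ js))
           (length (latestFirst k js) , point (u (js zero)) u (latestFirst k js))
    same zero    js = ≡.refl
    same (suc k) js = ≡.cong (λ (l , p) → suc l , ⟨ p , u (js (fromℕ (suc k))) ⟩) (same k (js ⊙ inject₁))

  -- π n extended by 0 to all of ℕ.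

  coord : ∀ n → ℕ → Hom (S[ n ] X) X
  coord zero    zero    = id
  coord zero    (suc i) = 0ₕ
  coord (suc n) zero    = fst
  coord (suc n) (suc i) = coord n i ∘ snd

  linear-coord : ∀ n i → Linear (coord {X} n i)
  linear-coord zero    zero    = linear-id
  linear-coord zero    (suc i) = linear-0
  linear-coord (suc n) zero    = D-fst
  linear-coord (suc n) (suc i) = linear-∘ (linear-coord n i) D-snd

  π-coord : ∀ n i → π n {X} i ≡ coord n (toℕ i)
  π-coord zero    zero    = ≡.refl
  π-coord (suc n) zero    = ≡.refl
  π-coord (suc n) (suc i) = ≡.cong (_∘ snd) (π-coord n i)

  coord-⟪⟫ : ∀ n {fs : Vector (Hom Z X) (suc n)} {u : ℕ → Hom Z X} → (∀ i → fs i ≈ u (toℕ i)) →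
             ∀ {i} → i ≤ n → coord n i ∘ ⟪ fs ⟫ ≈ u i
  coord-⟪⟫ zero    eq ℕ.z≤n       = trans (identityˡ _) (eq zero)
  coord-⟪⟫ (suc n) eq ℕ.z≤n       = trans (fst-⟨,⟩ _ _) (eq zero)
  coord-⟪⟫ (suc n) eq (s≤s i≤n) = trans (∘snd-⟨⟩ _ _ _) (coord-⟪⟫ n (eq ⊙ suc) i≤n)

  taylorTerm : Hom X Y → ∀ n → List ℕ → Hom (S[ n ] X) Y
  taylorTerm f n = multi∂ f (coord n 0) (coord n)

  -- Along `ν` the base point moves by 1/(n + 1) times coordinate 1, and the direction of a part i
  -- by (i + 1)/(n + 1) times coordinate i + 1. Linearity in the outermost direction pulls out these
  -- scalars.
  D-taylorTerm : ∀ (f : Hom X Y) n is → sum is ≡ n →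
                 D (taylorTerm f n is) ∘ ν (suc n) ≈
                 1/ suc n *ₗ (taylorTerm f (suc n) (1 ∷ is) + incrementSum (taylorTerm f (suc n)) is)
  D-taylorTerm {X} f n is sum≡n = begin
    D (taylorTerm f n is) ∘ ⟨ ⟪ α ⟫ , ⟪ β ⟫ ⟩
      ≈⟨ D-∘-linear (∂ f k) (linear-point (linear-coord n 0) (linear-coord n) is) _ _ ⟩
    D (∂ f k) ∘ ⟨ point (coord n 0) (coord n) is ∘ ⟪ α ⟫ , point (coord n 0) (coord n) is ∘ ⟪ β ⟫ ⟩
      ≈⟨ ∘-congˡ (⟨⟩-cong (point-⟪⟫ coord-α) (point-⟪⟫ coord-β)) ⟩
    D (∂ f k) ∘ ⟨ point (coord (suc n) 0) (coord (suc n)) is , point (w 0) w is ⟩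
      ≈⟨ D∂-point f _ _ _ _ is ⟩
    ∂ f (suc k) ∘ ⟨ point (coord (suc n) 0) (coord (suc n)) is , w 0 ⟩ +
    pickSum (λ h t → ∂ f (suc (length t)) ∘ ⟨ point (coord (suc n) 0) (coord (suc n)) t , w h ⟩) is
      ≈⟨ +-cong (trans (scale 0 is) (*-congˡ (fromNat-1-*ₗ _))) (pickSum-cong scale is) ⟩
    1/ suc n *ₗ taylorTerm f (suc n) (1 ∷ is) +
    pickSum (λ h t → 1/ suc n *ₗ fromNat R (suc h) *ₗ taylorTerm f (suc n) (suc h ∷ t)) is
      ≈⟨ +-congˡ (Scaling.pickSum-homo (1/ suc n) _ is) ⟨
    1/ suc n *ₗ taylorTerm f (suc n) (1 ∷ is) + 1/ suc n *ₗ incrementSum (taylorTerm f (suc n)) is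
      ≈⟨ Homs.*ₗ-distribˡ _ _ _ ⟨
    1/ suc n *ₗ (taylorTerm f (suc n) (1 ∷ is) + incrementSum (taylorTerm f (suc n)) is)
      ∎
    where
    k = length is

    α β : Vector (Hom (S[ suc n ] X) X) (suc n)
    α i = π (suc n) (inject₁ i)
    β i = frac (suc (toℕ i)) (suc n) *ₗ π (suc n) (suc i)

    w : ℕ → Hom (S[ suc n ] X) X
    w i = frac (suc i) (suc n) *ₗ coord (suc n) (suc i)

    coord-α : ∀ {i} → i ≤ n → coord n i ∘ ⟪ α ⟫ ≈ coord (suc n) i
    coord-α = coord-⟪⟫ n λ i →
      reflexive (≡.trans (π-coord (suc n) (inject₁ i)) (≡.cong (coord (suc n)) (toℕ-inject₁ i)))

    coord-β : ∀ {i} → i ≤ n → coord n i ∘ ⟪ β ⟫ ≈ w i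
    coord-β = coord-⟪⟫ n {u = w} λ i → *-congˡ (reflexive (π-coord (suc n) (suc i)))

    point-⟪⟫ : ∀ {fs : Vector (Hom (S[ suc n ] X) X) (suc n)} {u : ℕ → Hom (S[ suc n ] X) X} →
               (∀ {i} → i ≤ n → coord n i ∘ ⟪ fs ⟫ ≈ u i) →
               point (coord n 0) (coord n) is ∘ ⟪ fs ⟫ ≈ point (u 0) u is
    point-⟪⟫ eq = trans (point-∘ _ _ is _)
      -- No part exceeds the total `n`. A part n + 1 would meet the default 0 of `coord n`, where
      -- `coord (suc n)` is a genuine projection.
      (point-cong (eq ℕ.z≤n) (ListAll.map eq (parts-≤ is (ℕ.≤-reflexive sum≡n))))

    scale : ∀ h t → ∂ f (suc (length t)) ∘ ⟨ point (coord (suc n) 0) (coord (suc n)) t , w h ⟩ ≈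
                    1/ suc n *ₗ fromNat R (suc h) *ₗ taylorTerm f (suc n) (suc h ∷ t)
    scale h t = trans (∂-suc-* f (length t) _ _ _) (Homs.*ₗ-assoc _ _ _)

  -- Because `expSum` includes k = 0, the formula also holds at n = 0, where the empty composition
  -- gives `f`, and the induction can start there.
  t-expSum : ∀ n (f : Hom X Y) → t n f ≈ expSum n (taylorTerm f n)
  t-expSum zero    f = sym (begin
    1/fact 0 *ₗ (f ∘ id) + 0ₕ             ≈⟨ Homs.+ᴹ-identityʳ _ ⟩
    -- `1/fact 0` is the inverse supplied for the number 1 and need not be `1#` by definition, so it
    -- is cancelled against `fromNat R 1`.
    1/fact 0 *ₗ (f ∘ id)                  ≈⟨ *-congˡ (fromNat-1-*ₗ _) ⟨
    1/fact 0 *ₗ fromNat R 1 *ₗ (f ∘ id)   ≈⟨ Homs.*ₗ-assoc _ _ _ ⟨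
    _ *ₗ (f ∘ id)                         ≈⟨ Homs.*ₗ-congʳ (proj₂ (inv 1)) ⟩
    _ *ₗ (f ∘ id)                         ≈⟨ Homs.*ₗ-identityˡ _ ⟩
    f ∘ id                                ≈⟨ identityʳ f ⟩
    f                                     ∎)
  t-expSum {X} {Y} (suc n) f = begin
    D (t n f) ∘ ν (suc n)
      ≈⟨ ∘-congʳ (D-cong (t-expSum n f)) ⟩
    D (expSum n (taylorTerm f n)) ∘ ν (suc n)
      ≈⟨ ExpHomomorphism.expSum-homo inv (hom (S[ n ] X) Y) (hom (S[ suc n ] X) Y)
           (λ g h → trans (∘-congʳ (Additive.+ᴹ-homo D-additive g h)) (+-∘ _ _ _))
           (trans (∘-congʳ (Additive.0ᴹ-homo D-additive)) (0-∘ _))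
           (λ c g → trans (∘-congʳ (Additive.*ₗ-homo D-additive c g)) (*-∘ _ _ _))
           n (taylorTerm f n) ⟩
    expSum n (λ is → D (taylorTerm f n is) ∘ ν (suc n))
      ≈⟨ expSum-cong n (D-taylorTerm f n) ⟩
    expSum n (λ is → 1/ suc n *ₗ (taylorTerm f (suc n) (1 ∷ is) + incrementSum (taylorTerm f (suc n)) is))
      ≈⟨ ExpHomomorphism.expSum-homo inv (hom (S[ suc n ] X) Y) (hom (S[ suc n ] X) Y)
           (Homs.*ₗ-distribˡ (1/ suc n)) (Homs.*ₗ-zeroʳ _) (Homs.*ₗ-comm _)
           n (λ is → taylorTerm f (suc n) (1 ∷ is) + incrementSum (taylorTerm f (suc n)) is) ⟨
    1/ suc n *ₗ expSum n (λ is → taylorTerm f (suc n) (1 ∷ is) + incrementSum (taylorTerm f (suc n)) is)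
      ≈⟨ expSum-suc n (multi∂-↭ f _ _) ⟨
    expSum (suc n) (taylorTerm f (suc n))
      ∎

  ⁽⁾-taylorTerm : ∀ (f : Hom X Y) n {k} (is : Vec (Fin (suc n)) k) →
                  f ⁽ k ⁾ ∘ ⟪ (λ j → π n (lookup (zero ∷ is) j)) ⟫ ≈ taylorTerm f n (parts is)
  ⁽⁾-taylorTerm f n {k} is = begin
    f ⁽ k ⁾ ∘ ⟪ (λ j → π n (lookup (zero ∷ is) j)) ⟫
      ≈⟨ ⁽⁾-∂ f k _ ⟩
    ∂ f k ∘ snocPoint k (λ j → π n (lookup (zero ∷ is) j))
      ≈⟨ ∘-congˡ (snocPoint-cong k (λ j → reflexive (π-coord n (lookup (zero ∷ is) j)))) ⟩
    ∂ f k ∘ snocPoint k (coord n ⊙ js)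
      ≈⟨ reflexive (∂-snocPoint f (coord n) k js) ⟩
    taylorTerm f n (latestFirst k js)
      ≈⟨ multi∂-↭ f _ _ (latestFirst-↭ k js) ⟩
    taylorTerm f n (List.tabulate (λ j → toℕ (lookup is j)))
      ≈⟨ reflexive (≡.cong (taylorTerm f n) (tabulate-lookup-toℕ is)) ⟩
    taylorTerm f n (parts is)
      ∎
    where
    js : Vector ℕ (suc k)
    js j = toℕ (lookup (zero ∷ is) j)

  compositions-expTerm : ∀ (f : Hom X Y) n k →
    (∑[ is ∈ compositions n k ] 1/fact k *ₗ (f ⁽ k ⁾ ∘ ⟪ (λ j → π n (lookup (zero ∷ is) j)) ⟫)) ≈
    expTerm n (taylorTerm f n) k
  compositions-expTerm f n k = begin
    (∑[ is ∈ compositions n k ] 1/fact k *ₗ (f ⁽ k ⁾ ∘ ⟪ (λ j → π n (lookup (zero ∷ is) j)) ⟫))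
      ≈⟨ foldSum-cong (λ is → *-congˡ (⁽⁾-taylorTerm f n is)) (compositions n k) ⟩
    foldSum (compositions n k) (λ is → 1/fact k *ₗ taylorTerm f n (parts is))
      ≈⟨ foldSum-compositions n k (λ is → 1/fact k *ₗ taylorTerm f n is) ⟩
    compositionSum n k (λ is → 1/fact k *ₗ taylorTerm f n is)
      ≈⟨ Scaling.compositionSum-homo (1/fact k) n k (taylorTerm f n) ⟨
    expTerm n (taylorTerm f n) k
      ∎

theorem3 : ∀ {r ℓr o m ℓm : Level} (R : CommutativeSemiring r ℓr)
               (inv : HasIntegerInverses R)
               (C : CartesianDifferentialCategory R o m ℓm) →
             let open CartesianDifferentialCategory C
                 open Taylor inv C
             in
             ∀ (n : ℕ) → 1 ≤ n → ∀ {X Y : Obj} (f : Hom X Y) →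
             t n f ≈ (∑[ k ∈ applyUpTo suc n ] ∑[ is ∈ compositions n k ]
                        1/fact k *ₗ ((f ⁽ k ⁾) ∘ ⟪ (λ j → π n (lookup (zero ∷ is) j)) ⟫))
theorem3 R inv C n@(suc n-1) _ f = ≈ᴹ-trans (t-expSum n f) (expSum-suc-foldSum n-1 (compositions-expTerm f n))
  where
  open TaylorExpansion inv C
  open DifferentialCalculus.Homs C using (≈ᴹ-trans)
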